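{- Every $2$-saturated subcubic graph $G$ such that $g_3(G)=3$ is $(1,1,2)$-packing colorable.
   Context: All graphs are finite, simple and undirected. For a non-decreasing sequence $S=(s_1,\dots,s_k)$ of positive integers, an $S$-packing coloring of $G$ is a partition of $V(G)$ into sets $V_1,\dots,V_k$ such that any two distinct vertices $u,v\in V_i$ satisfy $dist_G(u,v)>s_i$; $G$ is $S$-packing colorable if it admits one. $G$ is subcubic if its maximum degree is at most $3$. A subcubic graph is $k$-saturated if every vertex of degree $3$ is adjacent to at most $k$ vertices of degree $3$. The local girth $g(v)$ of a vertex $v$ is the length of a shortest cycle containing $v$ ($\infty$ if none), and $g_3(G)=\max\{g(v): d_G(v)=3\}$. -}

module Defs where

open import Data.Nat using (ℕ; zero; suc; _≤_; _<_; _≡ᵇ_)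
open import Data.Bool using (Bool; true; false; T; _∧_)
open import Data.Fin using (Fin; zero; suc; inject₁; fromℕ)
open import Data.List using (List; length; filterᵇ; allFin)
open import Data.Product using (Σ; ∃; _×_; _,_)
open import Relation.Binary.PropositionalEquality using (_≡_; _≢_)
open import Relation.Nullary using (¬_)
open import Function.Definitions using (Injective)

record Graph : Set where
  field
    n     : ℕ
    adj   : Fin n → Fin n → Bool
    sym   : ∀ u v → adj u v ≡ adj v u
    irr   : ∀ v → adj v v ≡ false

module _ (G : Graph) where
  open Graph G

  Adj : Fin n → Fin n → Set
  Adj u v = T (adj u v)

  degree : Fin n → ℕ
  degree v = length (filterᵇ (adj v) (allFin n))

  Subcubic : Set
  Subcubic = ∀ v → degree v ≤ 3

  deg3Neighbours : Fin n → ℕ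
  deg3Neighbours v = length (filterᵇ (λ w → adj v w ∧ (degree w ≡ᵇ 3)) (allFin n))

  Saturated : ℕ → Set
  Saturated k = ∀ v → degree v ≡ 3 → deg3Neighbours v ≤ k

  data Walk : Fin n → Fin n → ℕ → Set where
    here : ∀ {v} → Walk v v 0
    step : ∀ {u w v ℓ} → Adj u w → Walk w v ℓ → Walk u v (suc ℓ)

  -- dist_G(u,v) ≤ s  (false if u,v lie in different components)
  DistLe : Fin n → Fin n → ℕ → Set
  DistLe u v s = Σ ℕ λ ℓ → ℓ ≤ s × Walk u v ℓ

  OnCycleOfLength : Fin n → ℕ → Set
  OnCycleOfLength v zero = Data.Empty.⊥
    where import Data.Empty
  OnCycleOfLength v (suc m) =
    3 ≤ suc m ×
    Σ (Fin (suc m) → Fin n) λ c →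
      Injective _≡_ _≡_ c ×
      (∀ (i : Fin m) → Adj (c (inject₁ i)) (c (suc i))) ×
      Adj (c (fromℕ m)) (c zero) ×
      ∃ λ i → c i ≡ v

  LocalGirth : Fin n → ℕ → Set
  LocalGirth v k = OnCycleOfLength v k × (∀ j → j < k → ¬ OnCycleOfLength v j)

  -- g₃(G) = k : the maximum of g(v) over degree-3 vertices is k
  -- (attained by some degree-3 vertex, and every degree-3 vertex has finite
  --  local girth at most k)
  G3Is : ℕ → Set
  G3Is k =
    (∃ λ v → degree v ≡ 3 × LocalGirth v k) ×
    (∀ v → degree v ≡ 3 → ∃ λ j → LocalGirth v j × j ≤ k)

  PackingColoring : (k : ℕ) → (Fin k → ℕ) → Set
  PackingColoring k s =
    Σ (Fin n → Fin k) λ col →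
      ∀ u v → u ≢ v → col u ≡ col v → ¬ DistLe u v (s (col u))

S112 : Fin 3 → ℕ
S112 zero = 1
S112 (suc zero) = 1
S112 (suc (suc zero)) = 2

{-# OPTIONS --safe #-}
-- Disjoint triangles cover all vertices of degree 3. Give the colour of radius 2 to one vertex of
-- each triangle, chosen with degree 2 if possible; the conflicts between the other triangles pass
-- through vertices of degree 2 outside the triangles, and are avoided by a sinkless orientation.
-- The uncoloured rest has maximum degree 2. Its edges between triangle vertices form two
-- matchings, hence are 2-colourable. The vertices outside the triangles are inserted one by one
-- with Kempe changes. If inserting u closes an odd cycle through its neighbours p and q, then
-- either p lies in a triangle, whose radius-2 colour can be moved to p, or neither p nor q does,
-- and u can take the radius-2 colour itself unless p or q is isolated in the rest.
module Submission where

open import Defs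
import Data.Bool as Bool
open import Data.Bool using (Bool; true; false; T; T?; not; _∧_; if_then_else_)
open import Data.Bool.Properties using (T-≡; T-∧; not-¬; not-involutive)
open import Data.Empty using (⊥; ⊥-elim)
open import Data.Fin using (Fin; zero; suc)
open import Data.Fin.Properties using (_≟_; any?; injective⇒≤)
open import Data.Fin.Subset using (Subset; _∈_; _∉_; _∪_; ⁅_⁆; ∣_∣) renaming (⊥ to ∅)
open import Data.Fin.Subset.Properties
  using (_∈?_; x∈p∪q⁻; x∈p∪q⁺; x∈⁅x⁆; x∈⁅y⁆⇒x≡y; p⊂q⇒∣p∣<∣q∣; ∣p∣≤n; ∉⊥)
open import Data.List using (List; length; lookup; filterᵇ; allFin)
import Data.List.Membership.Propositional as List
open import Data.List.Membership.Propositional.Properties using (∈-filter⁺; ∈-allFin; ∈-lookup)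
import Data.List.Relation.Unary.Any as Any
open import Data.List.Relation.Unary.All as All using (All; []; _∷_)
open import Data.List.Relation.Unary.AllPairs using ([]; _∷_)
open import Data.List.Relation.Unary.Unique.Propositional using (Unique)
open import Data.List.Relation.Unary.Any.Properties using (lookup-index)
open import Data.Maybe using (Maybe; just; nothing)
open import Data.Maybe.Properties using (just-injective)
open import Data.Nat using (ℕ; zero; suc; _+_; _≤_; _<_; s≤s; _≡ᵇ_)
open import Data.Nat.Properties as ℕ using (≤-trans; ≤-reflexive; ≡⇒≡ᵇ)
open import Data.Product using (∃; ∃₂; _×_; _,_; proj₁; proj₂; uncurry)
open import Data.Sum using (_⊎_; inj₁; inj₂; [_,_]′)
open import Data.Vec using (tabulate)
open import Data.Vec.Properties using (lookup∘tabulate; []=⇒lookup; lookup⇒[]=)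
open import Data.Vec.Functional using (updateAt)
open import Data.Vec.Functional.Properties using (updateAt-updates; updateAt-minimal)
open import Function using (_∘_; const; case_of_; Equivalence)
open import Function.Definitions using (Injective)
open import Relation.Binary.PropositionalEquality
  using (_≡_; _≢_; refl; sym; trans; cong; subst; ≢-sym)
open import Relation.Nullary using (¬_; Dec; yes; no; contradiction)
open import Relation.Nullary.Decidable
  using (_×-dec_; _⊎-dec_; ¬?; isYes; toWitness; fromWitness; decidable-stable)
open import Relation.Unary using (Decidable)

-- The sinkless orientation lives on the triangles, linked by the vertices of degree 2 that join two
-- of them: choosing a vertex claims the link at it, and no link may be claimed from both sides. The
-- obstacle in the insertion stage is that `z`, on giving the radius-2 colour to its mate `p`, must
-- take the old colour of `p`, which its neighbour `z′` outside the triangle may have already. Then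
-- the Kempe chain of `p` is swapped before the move. That chain is a path with ends `p` and `q`,
-- while `z′`, of degree at most 2 and next to `z`, would be a third end; so `z′` keeps its colour
-- while that of `p` changes. The move creates no conflict at distance 2 because `p` leaves its
-- triangle only through `u`, and from there only towards `q`.

-- Counting, pointwise updates and an iteration principle

injection⇒≤length : ∀ {k} {A : Set} {xs : List A} (f : Fin k → A) →
  Injective _≡_ _≡_ f → (∀ i → f i List.∈ xs) → k ≤ length xs
injection⇒≤length {xs = xs} f f-inj f∈xs = injective⇒≤ {f = λ i → Any.index (f∈xs i)}
  λ {i} {j} eq → f-inj (trans (lookup-index (f∈xs i))
    (trans (cong (lookup xs) eq) (sym (lookup-index (f∈xs j)))))

private variable
  n : ℕ

infixl 6 _[_≔_]

_[_≔_] : {A : Set} → (Fin n → A) → Fin n → A → Fin n → A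
f [ x ≔ a ] = updateAt f x (const a)

≔-same : {A : Set} (f : Fin n → A) (x : Fin n) {a : A} → (f [ x ≔ a ]) x ≡ a
≔-same f x = updateAt-updates x f

≔-other : {A : Set} (f : Fin n → A) {x v : Fin n} {a : A} → v ≢ x → (f [ x ≔ a ]) v ≡ f v
≔-other f {x} {v} v≢x = updateAt-minimal v x f v≢x

≔-view : {A : Set} (f : Fin n → A) (x : Fin n) (a : A) (v : Fin n) →
  (v ≡ x × (f [ x ≔ a ]) v ≡ a) ⊎ (v ≢ x × (f [ x ≔ a ]) v ≡ f v)
≔-view f x a v with v ≟ x
... | yes refl = inj₁ (refl , ≔-same f x)
... | no v≢x = inj₂ (v≢x , ≔-other f v≢x)

module _ {P : Fin n → Set} (P? : Decidable P) where

  subset : Subset n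
  subset = tabulate (λ v → isYes (P? v))

  ∈-subset⁺ : ∀ {v} → P v → v ∈ subset
  ∈-subset⁺ {v} Pv = lookup⇒[]= v subset (trans (lookup∘tabulate _ v) (Equivalence.to T-≡ (fromWitness Pv)))

  ∈-subset⁻ : ∀ {v} → v ∈ subset → P v
  ∈-subset⁻ {v} v∈ = toWitness (Equivalence.from T-≡ (trans (sym (lookup∘tabulate _ v)) ([]=⇒lookup v∈)))

module _ {S : Set} {Done : S → Set} (M : S → Fin n → Set) (M? : ∀ s → Decidable (M s))
  (advance : ∀ s → Done s ⊎ ∃ λ s′ → (∀ {v} → M s v → M s′ v) × ∃ λ v → ¬ M s v × M s′ v) where

  -- Each advance keeps the vertices marked by `M` and marks a new one, so at most `n` advances are
  -- possible. Every iteration of the proof is an instance, with its invariants packed into `S`.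
  saturate : S → ∃ Done
  saturate s = go n s (ℕ.m≤m+n n _)
    where
    size : S → ℕ
    size s = ∣ subset (M? s) ∣

    -- `k` bounds the number of unmarked vertices; at `k = 0` all are marked and a further advance
    -- is absurd.
    go : ∀ k s → n ≤ k + size s → ∃ Done
    go k s n≤ with advance s
    ... | inj₁ done = s , done
    ... | inj₂ (s′ , grow , v , ¬Mv , M′v) = next k n≤
      where
      size< : size s < size s′
      size< = p⊂q⇒∣p∣<∣q∣
        ( (λ x∈ → ∈-subset⁺ (M? s′) (grow (∈-subset⁻ (M? s) x∈)))
        , v , ∈-subset⁺ (M? s′) M′v , (λ v∈ → ¬Mv (∈-subset⁻ (M? s) v∈)))

      next : ∀ k → n ≤ k + size s → ∃ Done
      next zero n≤ = contradiction (≤-trans size< (≤-trans (∣p∣≤n (subset (M? s′))) n≤)) ℕ.1+n≰n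
      next (suc k) n≤ = go k s′ (≤-trans n≤ (≤-trans (≤-reflexive (sym (ℕ.+-suc k _))) (ℕ.+-monoʳ-≤ k size<)))

-- Two-colouring a union of two matchings

module TwoMatchings
  (M N : Fin n → Fin n → Set) (M? : ∀ v → Decidable (M v)) (N? : ∀ v → Decidable (N v))
  (M-sym : ∀ {v w} → M v w → M w v) (N-sym : ∀ {v w} → N v w → N w v)
  (M-irr : ∀ {v} → ¬ M v v) (N-irr : ∀ {v} → ¬ N v v)
  (M-fun : ∀ {v w w′} → M v w → M v w′ → w ≡ w′)
  (N-fun : ∀ {v w w′} → N v w → N v w′ → w ≡ w′)
  where

  Partial : Set
  Partial = Fin n → Maybe Bool

  Open : Partial → Bool → Fin n → Set
  Open f β v = f v ≡ just β × ∃ λ w → N v w × f w ≡ nothing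

  -- The coloured set is closed under M and, since one alternating path is grown at a time, has at
  -- most two open ends, of opposite colours.
  record Growing (f : Partial) : Set where
    field
      closed   : ∀ {v w β} → M v w → f v ≡ just β → f w ≡ just (not β)
      proper   : ∀ {v w β} → N v w → f v ≡ just β → f w ≡ just β → ⊥
      one-open : ∀ {v v′ β} → Open f β v → Open f β v′ → v ≡ v′

  -- An `M`-unmatched `x` counts as its own partner, so that `ColourPair` needs no separate case:
  -- the update at `x` then overwrites the one at `y`.
  partner : ∀ x → ∃ λ y → (∀ {w} → M x w → w ≡ y) × (y ≢ x → M x y)
  partner x with any? (M? x)
  ... | yes (y , Mxy) = y , (λ Mxw → M-fun Mxw Mxy) , (λ _ → Mxy)
  ... | no ¬M = x , (λ Mxw → contradiction (_ , Mxw) ¬M) , (λ x≢x → contradiction refl x≢x)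

  nothing≢just : ∀ {A : Set} {m : Maybe A} {β} → m ≡ nothing → m ≡ just β → ⊥
  nothing≢just refl ()

  -- Colours a whole `M`-pair, `x` by `not α` and its partner by `α`. An open end of colour `α` next
  -- to `x` is thereby closed, and colour `α` can be open again only at the partner. `x-open` covers
  -- the case that `x` itself becomes an open end, which happens only when a new path starts.
  module ColourPair {f : Partial} (g : Growing f) (x : Fin n) (α : Bool) (fx : f x ≡ nothing)
    (x-proper : ∀ {q} → N x q → f q ≢ just (not α))
    (α-open : ∀ {v} → Open f α v → N x v)
    (x-open : ∀ {w v} → N x w → f w ≡ nothing → ¬ Open f (not α) v)
    where
    open Growing g

    y : Fin n
    y = proj₁ (partner x)

    is-partner : ∀ {w} → M x w → w ≡ y
    is-partner = proj₁ (proj₂ (partner x))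

    Mxy : y ≢ x → M x y
    Mxy = proj₂ (proj₂ (partner x))

    fy : y ≢ x → f y ≡ nothing
    fy y≢x with f y in eq
    ... | nothing = refl
    ... | just β = ⊥-elim (nothing≢just fx (closed (M-sym (Mxy y≢x)) eq))

    f′ : Partial
    f′ = f [ y ≔ just α ] [ x ≔ just (not α) ]

    f′x : f′ x ≡ just (not α)
    f′x = ≔-same _ x

    f′y : y ≢ x → f′ y ≡ just α
    f′y y≢x = trans (≔-other _ y≢x) (≔-same f y)

    data View (v : Fin n) : Set where
      is-x  : v ≡ x → f′ v ≡ just (not α) → View v
      is-y  : v ≡ y → y ≢ x → f′ v ≡ just α → View v
      other : v ≢ x → v ≢ y → f′ v ≡ f v → View v

    view : ∀ v → View v
    view v with ≔-view (f [ y ≔ just α ]) x (just (not α)) v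
    ... | inj₁ (v≡x , e) = is-x v≡x e
    ... | inj₂ (v≢x , e) with ≔-view f y (just α) v
    ... | inj₁ (refl , e′) = is-y refl v≢x (trans e e′)
    ... | inj₂ (v≢y , e′) = other v≢x v≢y (trans e e′)

    uncoloured : ∀ {v} → f′ v ≡ nothing → f v ≡ nothing
    uncoloured {v} f′v with view v
    ... | is-x _ e = ⊥-elim (nothing≢just f′v e)
    ... | is-y _ _ e = ⊥-elim (nothing≢just f′v e)
    ... | other _ _ e = trans (sym e) f′v

    coloured : ∀ {v β} → f v ≡ just β → f′ v ≡ just β
    coloured {v} fv with view v
    ... | is-x refl _ = ⊥-elim (nothing≢just fx fv)
    ... | is-y refl y≢x _ = ⊥-elim (nothing≢just (fy y≢x) fv)
    ... | other _ _ e = trans e fv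

    same : ∀ {m : Maybe Bool} {α β} → m ≡ just α → m ≡ just β → α ≡ β
    same p q = just-injective (trans (sym p) q)

    closed′ : ∀ {v w β} → M v w → f′ v ≡ just β → f′ w ≡ just (not β)
    closed′ {v} {w} Mvw f′v with view v
    ... | is-x refl e = trans (cong f′ w≡y) (trans (f′y y≢x) (cong just α≡))
      where
      w≡y = is-partner Mvw
      y≢x : y ≢ x
      y≢x y≡x = M-irr (subst (M x) (trans w≡y y≡x) Mvw)
      α≡ = trans (sym (not-involutive α)) (cong not (same e f′v))
    ... | is-y refl y≢x e =
      trans (cong f′ (M-fun Mvw (M-sym (Mxy y≢x)))) (trans f′x (cong (just ∘ not) (same e f′v)))
    ... | other _ _ e = coloured (closed Mvw (trans (sym e) f′v))

    proper-x : ∀ {w} → N x w → f′ w ≢ just (not α)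
    proper-x {w} Nxw f′w with view w
    ... | is-x refl _ = N-irr Nxw
    ... | is-y _ _ e = not-¬ refl (same e f′w)
    ... | other _ _ e = x-proper Nxw (trans (sym e) f′w)

    -- A neighbour of the still uncoloured `y` with colour `α` would be an open end, hence by
    -- `α-open` the `N`-neighbour of `x`, and so `x` and `y` would coincide.
    proper-y : ∀ {w} → y ≢ x → N y w → f′ w ≢ just α
    proper-y {w} y≢x Nyw f′w with view w
    ... | is-x _ e = not-¬ refl (same f′w e)
    ... | is-y refl _ _ = N-irr Nyw
    ... | other _ _ e =
      y≢x (N-fun (N-sym Nyw) (N-sym (α-open (trans (sym e) f′w , y , N-sym Nyw , fy y≢x))))

    proper′ : ∀ {v w β} → N v w → f′ v ≡ just β → f′ w ≡ just β → ⊥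
    proper′ {v} {w} Nvw f′v f′w with view v | view w
    ... | is-x refl e | _ = proper-x Nvw (trans f′w (trans (sym f′v) e))
    ... | is-y refl y≢x e | _ = proper-y y≢x Nvw (trans f′w (trans (sym f′v) e))
    ... | other _ _ _ | is-x refl e = proper-x (N-sym Nvw) (trans f′v (trans (sym f′w) e))
    ... | other _ _ _ | is-y refl y≢x e =
      proper-y y≢x (N-sym Nvw) (trans f′v (trans (sym f′w) e))
    ... | other _ _ e | other _ _ e′ = proper Nvw (trans (sym e) f′v) (trans (sym e′) f′w)

    data OpenView (β : Bool) (v : Fin n) : Set where
      at-x : v ≡ x → β ≡ not α → (∀ {v′} → ¬ Open f (not α) v′) → OpenView β v
      at-y : v ≡ y → β ≡ α → OpenView β v
      old  : β ≢ α → Open f β v → OpenView β v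

    open-view : ∀ {β v} → Open f′ β v → OpenView β v
    open-view {β} {v} (f′v , w , Nvw , f′w) with view v
    ... | is-x refl e = at-x refl (same f′v e) (x-open Nvw (uncoloured f′w))
    ... | is-y refl _ e = at-y refl (same f′v e)
    ... | other _ _ e = old β≢α open-v
      where
      open-v = trans (sym e) f′v , w , Nvw , uncoloured f′w
      -- An old open end of colour `α` has `x` as its `N`-neighbour, which is coloured now.
      β≢α : β ≢ α
      β≢α refl = nothing≢just
        (trans (cong f′ (N-fun (N-sym (α-open open-v)) Nvw)) f′w) f′x

    one-open′ : ∀ {v v′ β} → Open f′ β v → Open f′ β v′ → v ≡ v′
    one-open′ o o′ with open-view o | open-view o′
    ... | at-x refl _ _  | at-x refl _ _ = refl
    ... | at-x _ refl _  | at-y _ e = contradiction (sym e) (not-¬ refl)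
    ... | at-x _ refl none | old _ op = contradiction op none
    ... | at-y _ e       | at-x _ refl _ = contradiction (sym e) (not-¬ refl)
    ... | at-y refl _    | at-y refl _ = refl
    ... | at-y _ e       | old β≢α _ = contradiction e β≢α
    ... | old _ op       | at-x _ refl none = contradiction op none
    ... | old β≢α _      | at-y _ e = contradiction e β≢α
    ... | old _ op       | old _ op′ = one-open op op′

    grown : Growing f′
    grown = record { closed = closed′ ; proper = proper′ ; one-open = one-open′ }

  just? : (m : Maybe Bool) → Dec (∃ λ β → m ≡ just β)
  just? (just β) = yes (β , refl)
  just? nothing = no λ ()

  nothing? : (m : Maybe Bool) → Dec (m ≡ nothing)
  nothing? (just _) = no λ ()
  nothing? nothing = yes refl

  Complete : Partial → Set
  Complete f = ∀ v → ∃ λ β → f v ≡ just β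

  Longer : Partial → Partial → Set
  Longer f f′ = (∀ {v} → (∃ λ β → f v ≡ just β) → ∃ λ β → f′ v ≡ just β) ×
    ∃ λ v → ¬ (∃ λ β → f v ≡ just β) × ∃ λ β → f′ v ≡ just β

  extend : (s : ∃ Growing) → Complete (proj₁ s) ⊎ ∃ λ (s′ : ∃ Growing) → Longer (proj₁ s) (proj₁ s′)
  extend (f , g) with any? (λ x → nothing? (f x))
  ... | no all-coloured = inj₁ λ v → decide v
    where
    decide : ∀ v → ∃ λ β → f v ≡ just β
    decide v with f v in eq
    ... | just β = β , refl
    ... | nothing = contradiction (v , eq) all-coloured
  ... | yes (x₀ , fx₀)
    with any? (λ v → just? (f v) ×-dec any? (λ w → N? v w ×-dec nothing? (f w)))
  ... | yes (v , (α , fv) , x , Nvx , fx) = inj₂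
    ( (f′ , grown)
    , (λ (β , fv) → β , coloured fv)
    , x , (λ (β , fx′) → nothing≢just fx fx′) , not α , f′x)
    where
    open ColourPair g x α fx
      (λ Nxq fq → not-¬ refl (just-injective
        (trans (sym fv) (trans (cong f (N-fun (N-sym Nvx) Nxq)) fq))))
      (λ op → subst (N x) (Growing.one-open g (fv , x , Nvx , fx) op) (N-sym Nvx))
      (λ Nxw fw _ → nothing≢just fw (trans (cong f (N-fun Nxw (N-sym Nvx))) fv))
  -- Without open ends the coloured set is a union of components, so a new path may start anywhere
  -- and with either colour.
  ... | no none-open = inj₂
    ( (f′ , grown)
    , (λ (β , fv) → β , coloured fv)
    , x₀ , (λ (β , fx) → nothing≢just fx₀ fx) , false , f′x)
    where
    open ColourPair g x₀ true fx₀
      (λ Nxq fq → none-open (_ , (_ , fq) , x₀ , N-sym Nxq , fx₀))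
      (λ (fv , open-v) → contradiction (_ , (_ , fv) , open-v) none-open)
      (λ _ _ (fv , open-v) → none-open (_ , (_ , fv) , open-v))

  blank : ∃ Growing
  blank = const nothing , record
    { closed = λ _ () ; proper = λ _ () ; one-open = λ () }

  2-colouring : ∃ λ (f : Fin n → Bool) →
    (∀ {v w} → M v w → f v ≢ f w) × (∀ {v w} → N v w → f v ≢ f w)
  2-colouring with saturate (λ (f , _) v → ∃ λ β → f v ≡ just β) (λ (f , _) v → just? (f v)) extend blank
  ... | (f , g) , complete =
    (λ v → proj₁ (complete v))
    , (λ {v} {w} Mvw eq → not-¬ refl (just-injective
        (trans (cong just eq) (trans (sym (proj₂ (complete w))) (closed Mvw (proj₂ (complete v)))))))
    , (λ {v} {w} Nvw eq → proper Nvw (proj₂ (complete v)) (trans (proj₂ (complete w)) (cong just (sym eq))))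
    where open Growing g

-- Kempe chains in an induced subgraph of maximum degree two

module KempeChain (E : Fin n → Fin n → Set) (E? : ∀ v → Decidable (E v))
  (E-sym : ∀ {v w} → E v w → E w v) {A : Fin n → Set} (A? : Decidable A)
  (two : ∀ {v s t w} → A v → A s → A t → A w → E v s → E v t → E v w → s ≢ t → w ≡ s ⊎ w ≡ t)
  where

  End : Fin n → Set
  End v = ∀ {s t} → A s → A t → E v s → E v t → s ≡ t

  Closed : Subset n → Set
  Closed K = ∀ {v w} → v ∈ K → A w → E v w → w ∈ K

  Interior : Subset n → Fin n → Set
  Interior K v = ∃₂ λ s t → (s ∈ K × E v s) × (t ∈ K × E v t) × s ≢ t

  -- Invariant of a traversal from `p`: it can only be continued at the tip, and every vertex except
  -- `p` and the tip already has two neighbours in `K`, so it is not an `End`.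
  record Path (p : Fin n) : Set where
    field
      K        : Subset n
      tip      : Fin n
      start∈   : p ∈ K
      tip∈     : tip ∈ K
      K⊆A      : ∀ {v} → v ∈ K → A v
      closed   : ∀ {v w} → v ∈ K → v ≢ tip → A w → E v w → w ∈ K
      previous : tip ≡ p ⊎ ∃ λ s → s ∈ K × E tip s
      interior : ∀ {v} → v ∈ K → v ≡ p ⊎ v ≡ tip ⊎ Interior K v

  record Chain (p : Fin n) : Set where
    field
      K      : Subset n
      start∈ : p ∈ K
      K⊆A    : ∀ {v} → v ∈ K → A v
      closed : Closed K
      ends   : ∀ {v w} → v ∈ K → End v → v ≢ p → w ∈ K → End w → w ≢ p → v ≡ w

  -- Since `p` is an end, following the path in one direction exhausts its component: the previous
  -- vertex and the next one are all the neighbours that `two` allows the tip. An end other than `p`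
  -- can then only be the last tip.
  chain : ∀ {p} → A p → End p → Chain p
  chain {p} Ap p-end with saturate {Done = Finished} (λ s v → v ∈ Path.K s) (λ s v → v ∈? Path.K s) advance start
    where
    Finished : Path p → Set
    Finished s = ∀ {w} → A w → E (Path.tip s) w → w ∈ Path.K s

    start : Path p
    start = record
      { K = ⁅ p ⁆ ; tip = p ; start∈ = x∈⁅x⁆ p ; tip∈ = x∈⁅x⁆ p
      ; K⊆A = λ v∈ → subst A (sym (x∈⁅y⁆⇒x≡y p v∈)) Ap
      ; closed = λ v∈ v≢p → contradiction (x∈⁅y⁆⇒x≡y p v∈) v≢p
      ; previous = inj₁ refl
      ; interior = λ v∈ → inj₁ (x∈⁅y⁆⇒x≡y p v∈) }

    advance : ∀ s → Finished s ⊎ ∃ λ (s′ : Path p) →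
      (∀ {v} → v ∈ Path.K s → v ∈ Path.K s′) × ∃ λ v → v ∉ Path.K s × v ∈ Path.K s′
    advance s with any? (λ w → A? w ×-dec E? (Path.tip s) w ×-dec ¬? (w ∈? Path.K s))
    ... | no ¬exit = inj₁ λ {w} Aw Etw → decidable-stable (w ∈? Path.K s) λ w∉ → ¬exit (w , Aw , Etw , w∉)
    ... | yes (w , Aw , Etw , w∉) = inj₂ (s′ , old , w , w∉ , new)
      where
      open Path s

      K′ : Subset _
      K′ = K ∪ ⁅ w ⁆

      old : ∀ {v} → v ∈ K → v ∈ K′
      old v∈ = x∈p∪q⁺ (inj₁ v∈)

      new : w ∈ K′
      new = x∈p∪q⁺ (inj₂ (x∈⁅x⁆ w))

      view : ∀ {v} → v ∈ K′ → v ∈ K ⊎ v ≡ w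
      view v∈ with x∈p∪q⁻ K ⁅ w ⁆ v∈
      ... | inj₁ v∈K = inj₁ v∈K
      ... | inj₂ v∈w = inj₂ (x∈⁅y⁆⇒x≡y w v∈w)

      tip-closed : ∀ {u} → A u → E tip u → u ∈ K′
      tip-closed Au Etu with previous
      ... | inj₁ refl = subst (_∈ K′) (p-end Aw Au Etw Etu) new
      ... | inj₂ (s , s∈ , Ets) with two (K⊆A tip∈) (K⊆A s∈) Aw Au Ets Etw Etu (λ { refl → w∉ s∈ })
      ... | inj₁ refl = old s∈
      ... | inj₂ refl = new

      tip-interior : tip ≡ p ⊎ Interior K′ tip
      tip-interior with previous
      ... | inj₁ tip≡p = inj₁ tip≡p
      ... | inj₂ (s , s∈ , Ets) = inj₂ (s , w , (old s∈ , Ets) , (new , Etw) , λ { refl → w∉ s∈ })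

      interior′ : ∀ {v} → v ∈ K′ → v ≡ p ⊎ v ≡ w ⊎ Interior K′ v
      interior′ v∈ with view v∈
      ... | inj₂ v≡w = inj₂ (inj₁ v≡w)
      ... | inj₁ v∈K with interior v∈K
      ... | inj₁ v≡p = inj₁ v≡p
      ... | inj₂ (inj₂ (s , t , (s∈ , Es) , (t∈ , Et) , s≢t)) =
        inj₂ (inj₂ (s , t , (old s∈ , Es) , (old t∈ , Et) , s≢t))
      ... | inj₂ (inj₁ refl) with tip-interior
      ... | inj₁ tip≡p = inj₁ tip≡p
      ... | inj₂ int = inj₂ (inj₂ int)

      closed′ : ∀ {v u} → v ∈ K′ → v ≢ w → A u → E v u → u ∈ K′
      closed′ {v} v∈ v≢w Au Evu with view v∈ | v ≟ tip
      ... | inj₂ v≡w | _ = contradiction v≡w v≢w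
      ... | inj₁ _ | yes refl = tip-closed Au Evu
      ... | inj₁ v∈K | no v≢tip = old (closed v∈K v≢tip Au Evu)

      s′ : Path p
      s′ = record
        { K = K′ ; tip = w ; start∈ = old start∈ ; tip∈ = new
        ; K⊆A = λ v∈ → [ K⊆A , (λ { refl → Aw }) ]′ (view v∈)
        ; closed = closed′
        ; previous = inj₂ (tip , old tip∈ , E-sym Etw)
        ; interior = interior′ }
  ... | s , finished = record
    { K = K ; start∈ = start∈ ; K⊆A = K⊆A
    ; closed = λ {v} v∈ → case v ≟ tip of λ
        { (yes refl) → finished
        ; (no v≢tip) → closed v∈ v≢tip }
    ; ends = λ v∈ v-end v≢p w∈ w-end w≢p → trans (end≡tip v∈ v-end v≢p) (sym (end≡tip w∈ w-end w≢p)) }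
    where
    open Path s

    end≡tip : ∀ {v} → v ∈ K → End v → v ≢ p → v ≡ tip
    end≡tip v∈ v-end v≢p with interior v∈
    ... | inj₁ v≡p = contradiction v≡p v≢p
    ... | inj₂ (inj₁ v≡tip) = v≡tip
    ... | inj₂ (inj₂ (_ , _ , (s∈ , Es) , (t∈ , Et) , s≢t)) =
      contradiction (v-end (K⊆A s∈) (K⊆A t∈) Es Et) s≢t

-- Degree bounds from lists of distinct neighbours

lookup-injective : {A : Set} {xs : List A} → Unique xs → Injective _≡_ _≡_ (lookup xs)
lookup-injective (x∉ ∷ _) {zero} {zero} _ = refl
lookup-injective (x∉ ∷ _) {zero} {suc j} e = contradiction e (All.lookup x∉ (∈-lookup j))
lookup-injective (x∉ ∷ _) {suc i} {zero} e = contradiction (sym e) (All.lookup x∉ (∈-lookup i))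
lookup-injective (_ ∷ u) {suc i} {suc j} e = cong suc (lookup-injective u e)

unique⇒≤length-filter : ∀ (P : Fin n → Bool) {xs} → Unique xs → All (T ∘ P) xs →
  length xs ≤ length (filterᵇ P (allFin n))
unique⇒≤length-filter P {xs} u Pxs = injection⇒≤length (lookup xs) (lookup-injective u)
  λ i → ∈-filter⁺ (T? ∘ P) (∈-allFin _) (All.lookup Pxs (∈-lookup i))

module Packing (G : Graph) (subcubic : Subcubic G) (saturated : Saturated G 2) (girth : G3Is G 3) where

  open Graph G using (adj) renaming (n to order)

  V : Set
  V = Fin order

  E : V → V → Set
  E = Adj G

  E? : ∀ v → Decidable (E v)
  E? v w = T? (adj v w)

  E-sym : ∀ {v w} → E v w → E w v
  E-sym {v} {w} = subst T (Graph.sym G v w)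

  E-irr : ∀ {v} → ¬ E v v
  E-irr {v} e = subst T (Graph.irr G v) e

  E⇒≢ : ∀ {v w} → E v w → v ≢ w
  E⇒≢ e refl = E-irr e

  Big : V → Set
  Big v = degree G v ≡ 3

  Big? : Decidable Big
  Big? v = degree G v ℕ.≟ 3

  three⇒Big : ∀ {v a b c} → E v a → E v b → E v c → a ≢ b → a ≢ c → b ≢ c → Big v
  three⇒Big {v} Ea Eb Ec a≢b a≢c b≢c = ℕ.≤-antisym (subcubic v)
    (unique⇒≤length-filter (adj v) ((a≢b ∷ a≢c ∷ []) ∷ (b≢c ∷ []) ∷ [] ∷ []) (Ea ∷ Eb ∷ Ec ∷ []))

  small-nbr : ∀ {v a b d} → ¬ Big v → E v a → E v b → a ≢ b → E v d → d ≡ a ⊎ d ≡ b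
  small-nbr {a = a} {b} {d} ¬Bv Ea Eb a≢b Ed with d ≟ a | d ≟ b
  ... | yes d≡a | _ = inj₁ d≡a
  ... | no _ | yes d≡b = inj₂ d≡b
  ... | no d≢a | no d≢b = contradiction (three⇒Big Ea Eb Ed a≢b (≢-sym d≢a) (≢-sym d≢b)) ¬Bv

  nbr : ∀ {v a b c d} → E v a → E v b → E v c → a ≢ b → a ≢ c → b ≢ c → E v d →
    d ≡ a ⊎ d ≡ b ⊎ d ≡ c
  nbr {v} {a} {b} {c} {d} Ea Eb Ec a≢b a≢c b≢c Ed with d ≟ a | d ≟ b | d ≟ c
  ... | yes d≡a | _ | _ = inj₁ d≡a
  ... | no _ | yes d≡b | _ = inj₂ (inj₁ d≡b)
  ... | no _ | no _ | yes d≡c = inj₂ (inj₂ d≡c)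
  ... | no d≢a | no d≢b | no d≢c = contradiction
    (≤-trans (unique⇒≤length-filter (adj v)
      ((d≢a ∷ d≢b ∷ d≢c ∷ []) ∷ (a≢b ∷ a≢c ∷ []) ∷ (b≢c ∷ []) ∷ [] ∷ [])
      (Ed ∷ Ea ∷ Eb ∷ Ec ∷ [])) (subcubic v))
    ℕ.1+n≰n

  not-all-Big : ∀ {v a b c} → E v a → E v b → E v c → a ≢ b → a ≢ c → b ≢ c →
    Big a → Big b → Big c → ⊥
  not-all-Big {v} Ea Eb Ec a≢b a≢c b≢c Ba Bb Bc = ℕ.1+n≰n
    (≤-trans (unique⇒≤length-filter (λ w → adj v w ∧ (degree G w ≡ᵇ 3))
        ((a≢b ∷ a≢c ∷ []) ∷ (b≢c ∷ []) ∷ [] ∷ [])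
        (both Ea Ba ∷ both Eb Bb ∷ both Ec Bc ∷ []))
      (saturated v (three⇒Big Ea Eb Ec a≢b a≢c b≢c)))
    where
    both : ∀ {w} → E v w → Big w → T (adj v w ∧ (degree G w ≡ᵇ 3))
    both {w} e B = Equivalence.from T-∧ (e , ≡⇒≡ᵇ (degree G w) 3 B)

  -- Triangles and families of disjoint triangles

  Tri : V → V → V → Set
  Tri a b c = E a b × E b c × E c a

  Tri? : ∀ a b c → Dec (Tri a b c)
  Tri? a b c = E? a b ×-dec E? b c ×-dec E? c a

  rotate : ∀ {a b c} → Tri a b c → Tri b c a
  rotate (ab , bc , ca) = bc , ca , ab

  Big⇒Tri : ∀ {v} → Big v → ∃₂ (Tri v)
  Big⇒Tri {v} Bv with proj₂ girth v Bv
  ... | suc (suc (suc zero)) , ((_ , c , _ , path , close , i , ci≡v) , _) , _ = through i ci≡v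
    where
    tri : Tri (c zero) (c (suc zero)) (c (suc (suc zero)))
    tri = path zero , path (suc zero) , close

    through : ∀ i → c i ≡ v → ∃₂ (Tri v)
    through zero refl = _ , _ , tri
    through (suc zero) refl = _ , _ , rotate tri
    through (suc (suc zero)) refl = _ , _ , rotate (rotate tri)
  ... | suc (suc (suc (suc _))) , _ , s≤s (s≤s (s≤s ()))
  ... | suc (suc zero) , ((s≤s (s≤s ()) , _) , _) , _
  ... | suc zero , ((s≤s () , _) , _) , _

  reflect : ∀ {a b c} → Tri a b c → Tri a c b
  reflect (ab , bc , ca) = E-sym ca , E-sym bc , E-sym ab

  -- A family of vertex-disjoint triangles, encoded as a permutation that rotates each of them
  -- and fixes every other vertex.
  record Family : Set where
    field
      ρ    : V → V
      cyc  : ∀ v → ρ (ρ (ρ v)) ≡ v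
      move : ∀ v → ρ v ≡ v ⊎ E v (ρ v)

    In : V → Set
    In v = E v (ρ v)

    In? : Decidable In
    In? v = E? v (ρ v)

    ¬In⇒fixed : ∀ {v} → ¬ In v → ρ v ≡ v
    ¬In⇒fixed {v} v∉ with move v
    ... | inj₁ e = e
    ... | inj₂ v∈ = contradiction v∈ v∉

    ρ-injective : ∀ {v w} → ρ v ≡ ρ w → v ≡ w
    ρ-injective {v} {w} e = trans (sym (cyc v)) (trans (cong (ρ ∘ ρ) e) (cyc w))

    In-ρ : ∀ {v} → In v → In (ρ v)
    In-ρ {v} v∈ with move (ρ v)
    ... | inj₁ e = contradiction (sym (ρ-injective e)) (E⇒≢ v∈)
    ... | inj₂ ρv∈ = ρv∈

    In⇒Tri : ∀ {v} → In v → Tri v (ρ v) (ρ (ρ v))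
    In⇒Tri {v} v∈ = v∈ , In-ρ v∈ , subst (E _) (cyc v) (In-ρ (In-ρ v∈))

    Mate : V → V → Set
    Mate v w = In v × (w ≡ ρ v ⊎ w ≡ ρ (ρ v))

    Mate? : ∀ v → Decidable (Mate v)
    Mate? v w = In? v ×-dec (w ≟ ρ v ⊎-dec w ≟ ρ (ρ v))

    Mate-sym : ∀ {v w} → Mate v w → Mate w v
    Mate-sym {v} (v∈ , inj₁ refl) = In-ρ v∈ , inj₂ (sym (cyc v))
    Mate-sym {v} (v∈ , inj₂ refl) = In-ρ (In-ρ v∈) , inj₁ (sym (cyc v))

    Mate⇒E : ∀ {v w} → Mate v w → E v w
    Mate⇒E (v∈ , inj₁ refl) = v∈
    Mate⇒E (v∈ , inj₂ refl) = E-sym (proj₂ (proj₂ (In⇒Tri v∈)))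

    Mate⇒In : ∀ {v w} → Mate v w → In w
    Mate⇒In m = proj₁ (Mate-sym m)

    ρ≢ρρ : ∀ {v} → In v → ρ v ≢ ρ (ρ v)
    ρ≢ρρ v∈ = E⇒≢ (In-ρ v∈)

    Mate-trans : ∀ {u v w} → Mate v u → Mate v w → u ≢ w → Mate u w
    Mate-trans (v∈ , inj₁ refl) (_ , inj₁ refl) u≢w = contradiction refl u≢w
    Mate-trans (v∈ , inj₁ refl) (_ , inj₂ refl) u≢w = In-ρ v∈ , inj₁ refl
    Mate-trans {v = v} (v∈ , inj₂ refl) (_ , inj₁ refl) u≢w = In-ρ (In-ρ v∈) , inj₂ (cong ρ (sym (cyc v)))
    Mate-trans (v∈ , inj₂ refl) (_ , inj₂ refl) u≢w = contradiction refl u≢w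

    third : ∀ {u v w x} → Mate v u → Mate v w → u ≢ w → Mate v x → x ≡ u ⊎ x ≡ w
    third (v∈ , inj₁ refl) (_ , inj₁ refl) u≢w _ = contradiction refl u≢w
    third (v∈ , inj₂ refl) (_ , inj₂ refl) u≢w _ = contradiction refl u≢w
    third (v∈ , inj₁ refl) (_ , inj₂ refl) u≢w (_ , x≡) = x≡
    third (v∈ , inj₂ refl) (_ , inj₁ refl) u≢w (_ , inj₁ e) = inj₂ e
    third (v∈ , inj₂ refl) (_ , inj₁ refl) u≢w (_ , inj₂ e) = inj₁ e

    module _ {v u} (v∈ : In v) (Evu : E v u) (u∉ : ¬ Mate v u) where

      private
        ρ≢ : ρ v ≢ u
        ρ≢ e = u∉ (v∈ , inj₁ (sym e))

        ρρ≢ : ρ (ρ v) ≢ u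
        ρρ≢ e = u∉ (v∈ , inj₂ (sym e))

        Evρρ : E v (ρ (ρ v))
        Evρρ = Mate⇒E (v∈ , inj₂ refl)

      -- Two mates and `u` exhaust the degree bound 3. Hence a triangle vertex has at most one
      -- neighbour outside its triangle, and it has degree 3 if there is one.
      outer⇒Big : Big v
      outer⇒Big = three⇒Big v∈ Evρρ Evu (ρ≢ρρ v∈) ρ≢ ρρ≢

      outer-nbr : ∀ {w} → E v w → w ≡ u ⊎ Mate v w
      outer-nbr Evw with nbr v∈ Evρρ Evu (ρ≢ρρ v∈) ρ≢ ρρ≢ Evw
      ... | inj₁ e = inj₂ (v∈ , inj₁ e)
      ... | inj₂ (inj₁ e) = inj₂ (v∈ , inj₂ e)
      ... | inj₂ (inj₂ e) = inj₁ e

      outer-unique : ∀ {w} → E v w → ¬ Mate v w → w ≡ u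
      outer-unique Evw w∉ with outer-nbr Evw
      ... | inj₁ e = e
      ... | inj₂ m = contradiction m w∉

      -- Every use of 2-saturation passes through this form, with two of the three neighbours inside
      -- the triangle.
      ¬all-Big : Big (ρ v) → Big (ρ (ρ v)) → ¬ Big u
      ¬all-Big = not-all-Big v∈ Evρρ Evu (ρ≢ρρ v∈) ρ≢ ρρ≢

  open Family using () renaming (In to Covered)

  module AddTriangle (F : Family) {a b c} (tri : Tri a b c)
    (a∉ : ¬ Covered F a) (b∉ : ¬ Covered F b) (c∉ : ¬ Covered F c) where

    open Family F using (ρ; cyc; move; ρ-injective; ¬In⇒fixed)

    ρ′ : V → V
    ρ′ = ρ [ c ≔ a ] [ b ≔ c ] [ a ≔ b ]

    Outside : V → Set
    Outside v = v ≢ a × v ≢ b × v ≢ c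

    ρ′a : ρ′ a ≡ b
    ρ′a = ≔-same _ a

    ρ′b : ρ′ b ≡ c
    ρ′b = trans (≔-other _ (≢-sym (E⇒≢ (proj₁ tri)))) (≔-same _ b)

    ρ′c : ρ′ c ≡ a
    ρ′c = trans (≔-other _ (E⇒≢ (proj₂ (proj₂ tri))))
      (trans (≔-other _ (≢-sym (E⇒≢ (proj₁ (proj₂ tri))))) (≔-same ρ c))

    ρ′-outside : ∀ {v} → Outside v → ρ′ v ≡ ρ v
    ρ′-outside (≢a , ≢b , ≢c) = trans (≔-other _ ≢a) (trans (≔-other _ ≢b) (≔-other ρ ≢c))

    view : ∀ v → v ≡ a ⊎ v ≡ b ⊎ v ≡ c ⊎ Outside v
    view v with v ≟ a | v ≟ b | v ≟ c
    ... | yes e | _ | _ = inj₁ e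
    ... | no _ | yes e | _ = inj₂ (inj₁ e)
    ... | no _ | no _ | yes e = inj₂ (inj₂ (inj₁ e))
    ... | no ≢a | no ≢b | no ≢c = inj₂ (inj₂ (inj₂ (≢a , ≢b , ≢c)))

    -- Uncovered vertices are fixed points of the injective `ρ`, so no other vertex is mapped to
    -- them.
    outside-ρ : ∀ {v} → Outside v → Outside (ρ v)
    outside-ρ {v} (≢a , ≢b , ≢c) = avoid a∉ ≢a , avoid b∉ ≢b , avoid c∉ ≢c
      where
      avoid : ∀ {x} → ¬ Covered F x → v ≢ x → ρ v ≢ x
      avoid x∉ v≢x e = v≢x (ρ-injective (trans e (sym (¬In⇒fixed x∉))))

    cyc′ : ∀ v → ρ′ (ρ′ (ρ′ v)) ≡ v
    cyc′ v with view v
    ... | inj₁ refl = trans (cong (ρ′ ∘ ρ′) ρ′a) (trans (cong ρ′ ρ′b) ρ′c)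
    ... | inj₂ (inj₁ refl) = trans (cong (ρ′ ∘ ρ′) ρ′b) (trans (cong ρ′ ρ′c) ρ′a)
    ... | inj₂ (inj₂ (inj₁ refl)) = trans (cong (ρ′ ∘ ρ′) ρ′c) (trans (cong ρ′ ρ′a) ρ′b)
    ... | inj₂ (inj₂ (inj₂ out)) = trans (cong (ρ′ ∘ ρ′) (ρ′-outside out))
      (trans (cong ρ′ (ρ′-outside (outside-ρ out)))
        (trans (ρ′-outside (outside-ρ (outside-ρ out))) (cyc v)))

    a∈ : E a (ρ′ a)
    a∈ = subst (E a) (sym ρ′a) (proj₁ tri)

    move′ : ∀ v → ρ′ v ≡ v ⊎ E v (ρ′ v)
    move′ v with view v
    ... | inj₁ refl = inj₂ a∈
    ... | inj₂ (inj₁ refl) = inj₂ (subst (E b) (sym ρ′b) (proj₁ (proj₂ tri)))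
    ... | inj₂ (inj₂ (inj₁ refl)) = inj₂ (subst (E c) (sym ρ′c) (proj₂ (proj₂ tri)))
    ... | inj₂ (inj₂ (inj₂ out)) = subst (λ w → w ≡ v ⊎ E v w) (sym (ρ′-outside out)) (move v)

    added : Family
    added = record { ρ = ρ′ ; cyc = cyc′ ; move = move′ }

    old⇒added : ∀ {v} → Covered F v → Covered added v
    old⇒added {v} v∈ = subst (E v) (sym (ρ′-outside
      ((λ { refl → a∉ v∈ }) , (λ { refl → b∉ v∈ }) , (λ { refl → c∉ v∈ })))) v∈

    added⇒old : ∀ {v} → Covered added v → v ≡ a ⊎ v ≡ b ⊎ v ≡ c ⊎ Covered F v
    added⇒old {v} v∈ with view v
    ... | inj₁ e = inj₁ e
    ... | inj₂ (inj₁ e) = inj₂ (inj₁ e)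
    ... | inj₂ (inj₂ (inj₁ e)) = inj₂ (inj₂ (inj₁ e))
    ... | inj₂ (inj₂ (inj₂ out)) = inj₂ (inj₂ (inj₂ (subst (E v) (ρ′-outside out) v∈)))

  AllBig : Family → Set
  AllBig F = ∀ {v} → Covered F v → Big v

  CoversBigTriangles : Family → Set
  CoversBigTriangles F = ∀ {a b c} → Tri a b c → Big a → Big b → Big c → Covered F a

  Covers : Family → Set
  Covers F = ∀ {v} → Big v → Covered F v

  -- Triangles with three vertices of degree 3 must come first: if two triangles share an edge,
  -- taking the one whose far vertex has degree 2 would leave a far vertex of degree 3 uncovered.
  -- Among these triangles overlaps cannot occur, since a covered vertex next to an uncovered one of
  -- degree 3 would have three neighbours of degree 3.
  big-triangles : ∃ CoversBigTriangles
  big-triangles with saturate {Done = CoversBigTriangles ∘ proj₁} (Covered ∘ proj₁) (Family.In? ∘ proj₁) advance start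
    where
    start : ∃ AllBig
    start = record { ρ = λ v → v ; cyc = λ _ → refl ; move = λ _ → inj₁ refl } ,
      λ v∈ → contradiction v∈ E-irr

    disjoint : ∀ (F : Family) → AllBig F → ∀ {v a} → Big v → ¬ Covered F v → E v a → ¬ Covered F a
    disjoint F all-big Bv v∉ Eva a∈ =
      ¬all-Big a∈ (E-sym Eva) (λ m → v∉ (Mate⇒In m)) (all-big (In-ρ a∈)) (all-big (In-ρ (In-ρ a∈))) Bv
      where open Family F

    advance : (s : ∃ AllBig) → CoversBigTriangles (proj₁ s) ⊎ ∃ λ (s′ : ∃ AllBig) →
      (∀ {v} → Covered (proj₁ s) v → Covered (proj₁ s′) v) × ∃ λ v → ¬ Covered (proj₁ s) v × Covered (proj₁ s′) v
    advance (F , all-big)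
      with any? (λ a → ¬? (Family.In? F a) ×-dec any? λ b → any? λ c →
        Tri? a b c ×-dec Big? a ×-dec Big? b ×-dec Big? c)
    ... | no none = inj₁ λ {a} tri Ba Bb Bc →
      decidable-stable (Family.In? F a) λ a∉ → none (a , a∉ , _ , _ , tri , Ba , Bb , Bc)
    ... | yes (a , a∉ , b , c , tri , Ba , Bb , Bc) = inj₂
      ((added , λ v∈ → bigs (added⇒old v∈)) , old⇒added , a , a∉ , a∈)
      where
      open AddTriangle F tri a∉ (disjoint F all-big Ba a∉ (proj₁ tri))
        (disjoint F all-big Ba a∉ (E-sym (proj₂ (proj₂ tri))))
      bigs : ∀ {v} → v ≡ a ⊎ v ≡ b ⊎ v ≡ c ⊎ Covered F v → Big v
      bigs (inj₁ refl) = Ba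
      bigs (inj₂ (inj₁ refl)) = Bb
      bigs (inj₂ (inj₂ (inj₁ refl))) = Bc
      bigs (inj₂ (inj₂ (inj₂ v∈))) = all-big v∈
  ... | (F , _) , covers = F , λ {a} → covers {a}

  -- A triangle that meets the family but has an uncovered vertex of degree 3 shares an edge with
  -- the family, so all its vertices have degree 3; such triangles are covered already.
  covering : ∃ Covers
  covering with saturate {Done = Covers ∘ proj₁} (Covered ∘ proj₁) (Family.In? ∘ proj₁) advance big-triangles
    where
    disjoint : ∀ (F : Family) → CoversBigTriangles F → ∀ {v a b} → Big v → ¬ Covered F v → Tri v a b → ¬ Covered F a
    disjoint F covers {v} {a} {b} Bv v∉ tri@(va , ab , bv) a∈ = v∉ (covers tri Bv
      (outer⇒Big a∈ (E-sym va) not-mate) (outer⇒Big (Mate⇒In mate) bv not-mate))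
      where
      open Family F
      not-mate : ∀ {x} → ¬ Mate x v
      not-mate m = v∉ (Mate⇒In m)
      mate : Mate a b
      mate with outer-nbr a∈ (E-sym va) not-mate ab
      ... | inj₁ refl = contradiction bv E-irr
      ... | inj₂ m = m

    advance : (s : ∃ CoversBigTriangles) → Covers (proj₁ s) ⊎ ∃ λ (s′ : ∃ CoversBigTriangles) →
      (∀ {v} → Covered (proj₁ s) v → Covered (proj₁ s′) v) × ∃ λ v → ¬ Covered (proj₁ s) v × Covered (proj₁ s′) v
    advance (F , covers) with any? (λ v → Big? v ×-dec ¬? (Family.In? F v))
    ... | no none = inj₁ λ {v} Bv → decidable-stable (Family.In? F v) λ v∉ → none (v , Bv , v∉)
    ... | yes (v , Bv , v∉) with Big⇒Tri Bv
    ... | a , b , tri = inj₂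
      ((added , λ t Bx By Bz → old⇒added (covers t Bx By Bz)) , old⇒added , v , v∉ , a∈)
      where
      open AddTriangle F tri v∉ (disjoint F covers Bv v∉ tri) (disjoint F covers Bv v∉ (reflect tri))
  ... | (F , _) , covers = F , λ {v} → covers {v}

  -- Choosing the radius-2 vertex of each triangle

  module WithFamily (F : Family) (cover : Covers F) where

    open Family F

    ¬In⇒¬Big : ∀ {v} → ¬ In v → ¬ Big v
    ¬In⇒¬Big v∉ Bv = v∉ (cover Bv)

    small-Mate : ∀ {v u} → In v → ¬ Big v → E v u → Mate v u
    small-Mate {v} {u} v∈ ¬Bv Evu = decidable-stable (Mate? v u) λ u∉ → ¬Bv (outer⇒Big v∈ Evu u∉)

    Free : Subset order → V → Set
    Free C v = In v × v ∉ C × ρ v ∉ C × ρ (ρ v) ∉ C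

    Free? : ∀ C → Decidable (Free C)
    Free? C v = In? v ×-dec ¬? (v ∈? C) ×-dec ¬? (ρ v ∈? C) ×-dec ¬? (ρ (ρ v) ∈? C)

    Free⇒Mate∉ : ∀ {C v w} → Free C v → Mate v w → w ∉ C
    Free⇒Mate∉ (_ , _ , ρ∉ , _) (_ , inj₁ refl) = ρ∉
    Free⇒Mate∉ (_ , _ , _ , ρρ∉) (_ , inj₂ refl) = ρρ∉

    Free-ρ : ∀ {C v} → Free C v → Free C (ρ v)
    Free-ρ {C} {v} (v∈ , v∉C , ρ∉ , ρρ∉) = In-ρ v∈ , ρ∉ , ρρ∉ , subst (_∉ C) (sym (cyc v)) v∉C

    -- Choosing such a `w` would put two chosen vertices at distance 2 through `m`, which has degree
    -- at most 2.
    Blocked : Subset order → V → Set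
    Blocked C w = Free C w × ∃₂ λ m s → ¬ In m × E w m × E m s × s ∈ C

    -- With this, chosen vertices of different triangles are not adjacent, and a common neighbour of
    -- two of them lies outside all triangles.
    Safe : V → Set
    Safe v = ∀ {u} → E v u → In u → Mate v u

    -- Choosing one vertex from each triangle amounts to a sinkless orientation. It is found
    -- greedily, since always treating next the triangle that contains the blocked vertex
    -- keeps all blocked vertices equal.
    record Selection : Set where
      field
        C       : Subset order
        blocked : V
        C⊆In    : ∀ {v} → v ∈ C → In v
        safe    : ∀ {v} → v ∈ C → Safe v
        one     : ∀ {v w} → v ∈ C → w ∈ C → ¬ Mate v w
        apart   : ∀ {v w m} → v ∈ C → w ∈ C → ¬ In m → E v m → E w m → v ≡ w
        only    : ∀ {w} → Blocked C w → w ≡ blocked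

    -- A triangle vertex of degree less than 3 has only mates as neighbours, so it is safe and
    -- unblocked. If all three have degree 3, 2-saturation keeps the outer neighbour of `ρ x` from
    -- having degree 3, as it would have in another triangle; and `ρ x` is unblocked because only
    -- `x` can be blocked.
    choose : ∀ {C x} → Free C x → (∀ {w} → Blocked C w → w ≡ x) →
      ∃ λ y → Free C y × (y ≡ x ⊎ Mate x y) × Safe y × ¬ Blocked C y
    choose {C} {x} x-free blocked≡x with Big? x | Big? (ρ x) | Big? (ρ (ρ x))
    ... | no ¬B | _ | _ = x , x-free , inj₁ refl , (λ Exu _ → small-Mate (proj₁ x-free) ¬B Exu) ,
      λ (_ , _ , _ , m∉ , Exm , _) → m∉ (Mate⇒In (small-Mate (proj₁ x-free) ¬B Exm))
    ... | yes _ | no ¬B | _ =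
      ρ x , Free-ρ x-free , inj₂ (proj₁ x-free , inj₁ refl) , (λ Eyu _ → small-Mate (In-ρ (proj₁ x-free)) ¬B Eyu) ,
      λ (_ , _ , _ , m∉ , Eym , _) → m∉ (Mate⇒In (small-Mate (In-ρ (proj₁ x-free)) ¬B Eym))
    ... | yes _ | yes _ | no ¬B =
      ρ (ρ x) , Free-ρ (Free-ρ x-free) , inj₂ (proj₁ x-free , inj₂ refl) ,
      (λ Eyu _ → small-Mate (In-ρ (In-ρ (proj₁ x-free))) ¬B Eyu) ,
      λ (_ , _ , _ , m∉ , Eym , _) → m∉ (Mate⇒In (small-Mate (In-ρ (In-ρ (proj₁ x-free))) ¬B Eym))
    ... | yes Bx | yes _ | yes Bρρx =
      ρ x , Free-ρ x-free , inj₂ (proj₁ x-free , inj₁ refl) , safe ,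
      λ blocked → E⇒≢ (proj₁ x-free) (sym (blocked≡x blocked))
      where
      safe : Safe (ρ x)
      safe {u} Eyu u∈ = decidable-stable (Mate? (ρ x) u) λ u∉ →
        ¬all-Big (In-ρ (proj₁ x-free)) Eyu u∉ Bρρx (subst Big (sym (cyc x)) Bx)
          (outer⇒Big u∈ (E-sym Eyu) (u∉ ∘ Mate-sym))

    Hits : Selection → Set
    Hits s = ∀ {v} → ¬ Free (Selection.C s) v

    select : (s : Selection) → ∀ {x} → Free (Selection.C s) x → (∀ {w} → Blocked (Selection.C s) w → w ≡ x) →
      ∃ λ (s′ : Selection) → (∀ {v} → v ∈ Selection.C s → v ∈ Selection.C s′) ×
        ∃ λ v → v ∉ Selection.C s × v ∈ Selection.C s′
    select s {x} x-free blocked≡x with choose x-free blocked≡x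
    ... | y , y-free , y~x , y-safe , y-unblocked = s′ , old , y , proj₁ (proj₂ y-free) , new
      where
      open Selection s

      y∈ : In y
      y∈ = proj₁ y-free

      C′ : Subset order
      C′ = C ∪ ⁅ y ⁆

      old : ∀ {v} → v ∈ C → v ∈ C′
      old v∈ = x∈p∪q⁺ (inj₁ v∈)

      new : y ∈ C′
      new = x∈p∪q⁺ (inj₂ (x∈⁅x⁆ y))

      view : ∀ {v} → v ∈ C′ → v ∈ C ⊎ v ≡ y
      view v∈ with x∈p∪q⁻ C ⁅ y ⁆ v∈
      ... | inj₁ v∈C = inj₁ v∈C
      ... | inj₂ v∈y = inj₂ (x∈⁅y⁆⇒x≡y y v∈y)

      one′ : ∀ {v w} → v ∈ C′ → w ∈ C′ → ¬ Mate v w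
      one′ v∈ w∈ m with view v∈ | view w∈
      ... | inj₁ v∈C | inj₁ w∈C = one v∈C w∈C m
      ... | inj₁ v∈C | inj₂ refl = Free⇒Mate∉ y-free (Mate-sym m) v∈C
      ... | inj₂ refl | inj₁ w∈C = Free⇒Mate∉ y-free m w∈C
      ... | inj₂ refl | inj₂ refl = E-irr (Mate⇒E m)

      apart′ : ∀ {v w m} → v ∈ C′ → w ∈ C′ → ¬ In m → E v m → E w m → v ≡ w
      apart′ v∈ w∈ m∉ Evm Ewm with view v∈ | view w∈
      ... | inj₁ v∈C | inj₁ w∈C = apart v∈C w∈C m∉ Evm Ewm
      ... | inj₁ v∈C | inj₂ refl = contradiction (y-free , _ , _ , m∉ , Ewm , E-sym Evm , v∈C) y-unblocked
      ... | inj₂ refl | inj₁ w∈C = contradiction (y-free , _ , _ , m∉ , Evm , E-sym Ewm , w∈C) y-unblocked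
      ... | inj₂ refl | inj₂ refl = refl

      Beyond : V → V → Set
      Beyond w m = ¬ In m × E y m × E m w × w ≢ y

      -- `y` has at most one outer neighbour `m`, and `m` has at most one neighbour besides `y`; so
      -- the choice of `y` blocks at most one vertex.
      beyond-unique : ∀ {w m w₁ m₁} → Beyond w m → Beyond w₁ m₁ → w ≡ w₁
      beyond-unique (m∉ , Eym , Emw , w≢y) (m₁∉ , Eym₁ , Em₁w₁ , w₁≢y)
        with outer-unique y∈ Eym₁ (m₁∉ ∘ Mate⇒In) Eym (m∉ ∘ Mate⇒In)
      ... | refl with small-nbr (¬In⇒¬Big m∉) (E-sym Eym) Em₁w₁ (≢-sym w₁≢y) Emw
      ... | inj₁ w≡y = contradiction w≡y w≢y
      ... | inj₂ w≡w₁ = w≡w₁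

      Only : V → Set
      Only b = ∀ {w m} → Beyond w m → w ≡ b

      next : ∃ Only
      next with any? (λ w → any? λ m → ¬? (In? m) ×-dec E? y m ×-dec E? m w ×-dec ¬? (w ≟ y))
      ... | yes (w , m , beyond) = w , λ beyond′ → beyond-unique beyond′ beyond
      ... | no none = y , λ beyond → contradiction (_ , _ , beyond) none

      -- A vertex blocked by an older choice was blocked before, hence is `x`; but the triangle of
      -- `x` is no longer free. What remains is blocked by `y`.
      only′ : ∀ {w} → Blocked C′ w → w ≡ proj₁ next
      only′ {w} (w-free@(w∈ , w∉ , ρw∉ , ρρw∉) , m , s , m∉ , Ewm , Ems , s∈) with view s∈
      ... | inj₂ refl = proj₂ next (m∉ , E-sym Ems , E-sym Ewm , λ { refl → w∉ new })
      ... | inj₁ s∈C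
        with blocked≡x ((w∈ , w∉ ∘ old , ρw∉ ∘ old , ρρw∉ ∘ old) , m , s , m∉ , Ewm , Ems , s∈C)
      ... | refl = contradiction new ([ (λ { refl → w∉ }) , Free⇒Mate∉ w-free ]′ y~x)

      s′ : Selection
      s′ = record
        { C = C′ ; blocked = proj₁ next
        ; C⊆In = λ v∈ → [ C⊆In , (λ { refl → y∈ }) ]′ (view v∈)
        ; safe = λ v∈ → [ (λ v∈C → safe v∈C) , (λ { refl → y-safe }) ]′ (view v∈)
        ; one = one′ ; apart = apart′ ; only = only′ }

    selection : V → ∃ Hits
    selection v₀ with saturate {Done = Hits} (λ s v → v ∈ Selection.C s) (λ s v → v ∈? Selection.C s) advance start
      where
      start : Selection
      start = record
        -- Nothing is blocked yet, so any vertex can serve as `blocked`.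
        { C = ∅ ; blocked = v₀
        ; C⊆In = λ v∈ → contradiction v∈ ∉⊥ ; safe = λ v∈ → contradiction v∈ ∉⊥
        ; one = λ v∈ → contradiction v∈ ∉⊥ ; apart = λ v∈ → contradiction v∈ ∉⊥
        ; only = λ (_ , _ , _ , _ , _ , _ , s∈) → contradiction s∈ ∉⊥ }

      advance : ∀ s → Hits s ⊎ ∃ λ (s′ : Selection) → (∀ {v} → v ∈ Selection.C s → v ∈ Selection.C s′) ×
        ∃ λ v → v ∉ Selection.C s × v ∈ Selection.C s′
      advance s with Free? C blocked | any? (Free? C)
        where open Selection s
      ... | yes b-free | _ = inj₂ (select s b-free (Selection.only s))
      -- If `blocked` is in no free triangle, nothing is blocked, and any free triangle may be next.
      ... | no ¬b-free | yes (x , x-free) = inj₂ (select s x-free λ blocked →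
        contradiction (subst (Free (Selection.C s)) (Selection.only s blocked) (proj₁ blocked)) ¬b-free)
      ... | no _ | no none = inj₁ λ free → none (_ , free)
    ... | s , hits = s , λ {v} → hits {v}

    -- Valid partial colourings

    -- Deep is the colour of radius 2, the two pale colours have radius 1, blank is uncoloured.
    data Colour : Set where
      blank deep : Colour
      pale : Bool → Colour

    pale-injective : ∀ {β γ} → pale β ≡ pale γ → β ≡ γ
    pale-injective refl = refl

    infix 4 _≟ᶜ_

    _≟ᶜ_ : (c d : Colour) → Dec (c ≡ d)
    blank ≟ᶜ blank = yes refl
    blank ≟ᶜ deep = no λ ()
    blank ≟ᶜ pale _ = no λ ()
    deep ≟ᶜ blank = no λ ()
    deep ≟ᶜ deep = yes refl
    deep ≟ᶜ pale _ = no λ ()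
    pale _ ≟ᶜ blank = no λ ()
    pale _ ≟ᶜ deep = no λ ()
    pale β ≟ᶜ pale γ with β Bool.≟ γ
    ... | yes refl = yes refl
    ... | no β≢γ = no (β≢γ ∘ pale-injective)

    clash : ∀ {c d e : Colour} → c ≢ d → e ≡ c → e ≢ d
    clash c≢d refl e = c≢d e

    IsPale : Colour → Set
    IsPale c = ∃ λ β → c ≡ pale β

    isPale? : Decidable IsPale
    isPale? blank = no λ ()
    isPale? deep = no λ ()
    isPale? (pale β) = yes (β , refl)

    IsPale≢blank : ∀ {c} → IsPale c → c ≢ blank
    IsPale≢blank (_ , refl) ()

    IsPale≢deep : ∀ {c} → IsPale c → c ≢ deep
    IsPale≢deep (_ , refl) ()

    toggle : Colour → Colour
    toggle (pale β) = pale (not β)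
    toggle c = c

    toggle-pale : ∀ {c β} → toggle c ≡ pale β → c ≡ pale (not β)
    toggle-pale {pale γ} refl = cong pale (sym (not-involutive γ))

    -- Invariant of the insertion stage. Blank vertices lie outside the triangles, hence have degree
    -- at most 2. `hit` gives the pale subgraph maximum degree 2, so that Kempe chains are easy to
    -- follow; `safe` keeps the edges between triangles away from deep vertices.
    record Valid (col : V → Colour) : Set where
      field
        full   : ∀ {v} → In v → col v ≢ blank
        proper : ∀ {v w} → E v w → col v ≡ col w → col v ≡ blank
        pack   : ∀ {v w m} → col v ≡ deep → col w ≡ deep → E v m → E m w → v ≡ w
        safe   : ∀ {v} → col v ≡ deep → Safe v
        hit    : ∀ {v} → In v → col v ≡ deep ⊎ ∃ λ m → Mate v m × col m ≡ deep

      proper-pale : ∀ {v w β} → E v w → col v ≡ pale β → col w ≢ pale β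
      proper-pale Evw v-pale w-pale =
        IsPale≢blank (_ , v-pale) (proper Evw (trans v-pale (sym w-pale)))

      proper-deep : ∀ {v w} → E v w → col v ≡ deep → col w ≢ deep
      proper-deep Evw v-deep w-deep with trans (sym v-deep) (proper Evw (trans v-deep (sym w-deep)))
      ... | ()

      deep-mate : ∀ {v} → In v → IsPale (col v) → ∃ λ m → Mate v m × col m ≡ deep
      deep-mate v∈ v-pale with hit v∈
      ... | inj₁ v-deep = contradiction v-deep (IsPale≢deep v-pale)
      ... | inj₂ m = m

      Pale : V → Set
      Pale v = IsPale (col v)

      -- Three pale neighbours would give `v` degree 3, hence a triangle, whose deep vertex would be
      -- a fourth neighbour.
      pale-two : ∀ {v s t w} → Pale v → Pale s → Pale t → Pale w → E v s → E v t → E v w →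
        s ≢ t → w ≡ s ⊎ w ≡ t
      pale-two {v} {s} {t} {w} v-pale s-pale t-pale w-pale Es Et Ew s≢t with w ≟ s | w ≟ t
      ... | yes w≡s | _ = inj₁ w≡s
      ... | no _ | yes w≡t = inj₂ w≡t
      ... | no w≢s | no w≢t
        with deep-mate (cover (three⇒Big Es Et Ew s≢t (≢-sym w≢s) (≢-sym w≢t))) v-pale
      ... | m , mate , m-deep with nbr Es Et Ew s≢t (≢-sym w≢s) (≢-sym w≢t) (Mate⇒E mate)
      ... | inj₁ refl = contradiction m-deep (IsPale≢deep s-pale)
      ... | inj₂ (inj₁ refl) = contradiction m-deep (IsPale≢deep t-pale)
      ... | inj₂ (inj₂ refl) = contradiction m-deep (IsPale≢deep w-pale)

      open KempeChain E E? E-sym {A = Pale} (λ v → isPale? (col v)) pale-two public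

      -- A second pale neighbour would give `v` degree 3, hence a deep mate, for which there is no
      -- room beside `u` and the two pale ones.
      blank-nbr⇒End : ∀ {v u} → Pale v → E v u → col u ≡ blank → End v
      blank-nbr⇒End {v} {u} v-pale Evu u-blank {s} {t} s-pale t-pale Es Et = decidable-stable (s ≟ t) distinct
        where
        u≢ : ∀ {x} → Pale x → u ≢ x
        u≢ x-pale refl = IsPale≢blank x-pale u-blank

        distinct : ¬ s ≢ t
        distinct s≢t with deep-mate (cover (three⇒Big Evu Es Et (u≢ s-pale) (u≢ t-pale) s≢t)) v-pale
        ... | m , mate , m-deep with nbr Evu Es Et (u≢ s-pale) (u≢ t-pale) s≢t (Mate⇒E mate)
        ... | inj₁ refl = contradiction (trans (sym m-deep) u-blank) λ ()
        ... | inj₂ (inj₁ refl) = IsPale≢deep s-pale m-deep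
        ... | inj₂ (inj₂ refl) = IsPale≢deep t-pale m-deep

      deep-nbr⇒End : ∀ {v z} → ¬ In v → E v z → col z ≡ deep → End v
      deep-nbr⇒End {v} {z} v∉ Evz z-deep {s} {t} s-pale t-pale Es Et = decidable-stable (s ≟ t) λ s≢t →
        ¬In⇒¬Big v∉ (three⇒Big Evz Es Et (λ { refl → IsPale≢deep s-pale z-deep })
          (λ { refl → IsPale≢deep t-pale z-deep }) s≢t)

    -- Swapping the pale colours along a Kempe chain

    module Swap {col : V → Colour} (valid : Valid col) {p} (κ : Valid.Chain valid p) where

      open Valid valid
      open Chain κ

      swapped : V → Colour
      swapped v = if isYes (v ∈? K) then toggle (col v) else col v

      swapped-∈ : ∀ {v} → v ∈ K → swapped v ≡ toggle (col v)
      swapped-∈ {v} v∈ with v ∈? K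
      ... | yes _ = refl
      ... | no v∉ = contradiction v∈ v∉

      swapped-∉ : ∀ {v} → v ∉ K → swapped v ≡ col v
      swapped-∉ {v} v∉ with v ∈? K
      ... | yes v∈ = contradiction v∈ v∉
      ... | no _ = refl

      swapped-same : ∀ {v c} → col v ≡ c → ¬ IsPale c → swapped v ≡ c
      swapped-same {v} refl ¬pale with v ∈? K
      ... | yes v∈ = contradiction (K⊆A v∈) ¬pale
      ... | no _ = refl

      col-same : ∀ {v c} → swapped v ≡ c → ¬ IsPale c → col v ≡ c
      col-same {v} refl ¬pale with v ∈? K
      ... | no _ = refl
      ... | yes v∈ with col v | K⊆A v∈
      ... | pale β | _ = contradiction (not β , refl) ¬pale

      deep≢pale : ¬ IsPale deep
      deep≢pale ()

      blank≢pale : ¬ IsPale blank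
      blank≢pale ()

      -- `K` is closed in the pale subgraph, so no edge between pale vertices has exactly one end in
      -- it.
      swapped-proper : ∀ {v w} → E v w → ∀ {β} → swapped v ≡ pale β → swapped w ≢ pale β
      swapped-proper {v} {w} Evw v-pale w-pale with v ∈? K | w ∈? K
      ... | no _ | no _ = proper-pale Evw v-pale w-pale
      ... | yes _ | yes _ = proper-pale Evw (toggle-pale v-pale) (toggle-pale w-pale)
      ... | yes v∈ | no w∉ = w∉ (closed v∈ (_ , w-pale) Evw)
      ... | no v∉ | yes w∈ = v∉ (closed w∈ (_ , v-pale) (E-sym Evw))

      proper′ : ∀ {v w} → E v w → swapped v ≡ swapped w → swapped v ≡ blank
      proper′ {v} {w} Evw eq with swapped v in v-eq
      ... | blank = refl
      ... | deep = contradiction (col-same (sym eq) deep≢pale)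
        (proper-deep Evw (col-same v-eq deep≢pale))
      ... | pale β = contradiction (sym eq) (swapped-proper Evw v-eq)

      hit′ : ∀ {v} → In v → swapped v ≡ deep ⊎ ∃ λ m → Mate v m × swapped m ≡ deep
      hit′ v∈ with hit v∈
      ... | inj₁ v-deep = inj₁ (swapped-same v-deep deep≢pale)
      ... | inj₂ (m , mate , m-deep) = inj₂ (m , mate , swapped-same m-deep deep≢pale)

      swapped-filled : ∀ {v} → col v ≢ blank → swapped v ≢ blank
      swapped-filled v-filled v-blank = v-filled (col-same v-blank blank≢pale)

      swapped-valid : Valid swapped
      swapped-valid = record
        { full = λ v∈ → swapped-filled (full v∈)
        ; proper = proper′
        ; pack = λ v-deep w-deep → pack (col-same v-deep deep≢pale) (col-same w-deep deep≢pale)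
        ; safe = λ v-deep → safe (col-same v-deep deep≢pale)
        ; hit = hit′ }

    -- Recolouring a single vertex

    -- Colours may change freely, but no vertex may become blank again: the set of filled vertices
    -- is the measure of progress in `total-colouring`.
    Extension : (V → Colour) → V → Set
    Extension col u = ∃ λ col′ → Valid col′ × (∀ {v} → col v ≢ blank → col′ v ≢ blank) × col′ u ≢ blank

    via : ∀ {col col₁ u} → (∀ {v} → col v ≢ blank → col₁ v ≢ blank) → Extension col₁ u → Extension col u
    via keep (col′ , valid , keep′ , filled) = col′ , valid , keep′ ∘ keep , filled

    ≔-filled : ∀ {col : V → Colour} {u c} → c ≢ blank → ∀ {v} → col v ≢ blank → (col [ u ≔ c ]) v ≢ blank
    ≔-filled {col} {u} {c} c≢blank {v} v-filled with ≔-view col u c v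
    ... | inj₁ (_ , e) = c≢blank ∘ trans (sym e)
    ... | inj₂ (_ , e) = v-filled ∘ trans (sym e)

    module Recolour {col : V → Colour} (valid : Valid col) {u} (u≢deep : col u ≢ deep) where

      open Valid valid

      module _ {β} (free : ∀ {v} → E u v → col v ≢ pale β) where

        private
          col′ : V → Colour
          col′ = col [ u ≔ pale β ]

          deep⁻ : ∀ {v} → col′ v ≡ deep → col v ≡ deep
          deep⁻ {v} v-deep with ≔-view col u (pale β) v
          ... | inj₁ (_ , e) = contradiction (trans (sym e) v-deep) λ ()
          ... | inj₂ (_ , e) = trans (sym e) v-deep

          deep⁺ : ∀ {v} → col v ≡ deep → col′ v ≡ deep
          deep⁺ {v} v-deep with ≔-view col u (pale β) v
          ... | inj₁ (refl , _) = contradiction v-deep u≢deep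
          ... | inj₂ (_ , e) = trans e v-deep

          proper′ : ∀ {v w} → E v w → col′ v ≡ col′ w → col′ v ≡ blank
          proper′ {v} {w} Evw eq with ≔-view col u (pale β) v | ≔-view col u (pale β) w
          ... | inj₁ (refl , _) | inj₁ (refl , _) = contradiction Evw E-irr
          ... | inj₁ (refl , e) | inj₂ (_ , e′) =
            contradiction (trans (sym e′) (trans (sym eq) e)) (free Evw)
          ... | inj₂ (_ , e) | inj₁ (refl , e′) =
            contradiction (trans (sym e) (trans eq e′)) (free (E-sym Evw))
          ... | inj₂ (_ , e) | inj₂ (_ , e′) = trans e (proper Evw (trans (sym e) (trans eq e′)))

          hit′ : ∀ {v} → In v → col′ v ≡ deep ⊎ ∃ λ m → Mate v m × col′ m ≡ deep
          hit′ v∈ with hit v∈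
          ... | inj₁ v-deep = inj₁ (deep⁺ v-deep)
          ... | inj₂ (m , mate , m-deep) = inj₂ (m , mate , deep⁺ m-deep)

        pale-valid : Valid col′
        pale-valid = record
          { full = λ v∈ → ≔-filled (λ ()) (full v∈)
          ; proper = proper′
          ; pack = λ v-deep w-deep → pack (deep⁻ v-deep) (deep⁻ w-deep)
          ; safe = λ v-deep → safe (deep⁻ v-deep)
          ; hit = hit′ }

        pale-extension : Extension col u
        pale-extension = col′ , pale-valid , ≔-filled (λ ()) ,
          λ e → contradiction (trans (sym (≔-same col u)) e) λ ()

      module _ (u∉ : ¬ In u) (nbr∉ : ∀ {v} → E u v → ¬ In v)
        (nbr≢deep : ∀ {v} → E u v → col v ≢ deep)
        (far≢deep : ∀ {v w} → E u v → E v w → col w ≢ deep) where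

        private
          col′ : V → Colour
          col′ = col [ u ≔ deep ]

          deep⁺ : ∀ {v} → col v ≡ deep → col′ v ≡ deep
          deep⁺ {v} v-deep with ≔-view col u deep v
          ... | inj₁ (_ , e) = e
          ... | inj₂ (_ , e) = trans e v-deep

          proper′ : ∀ {v w} → E v w → col′ v ≡ col′ w → col′ v ≡ blank
          proper′ {v} {w} Evw eq with ≔-view col u deep v | ≔-view col u deep w
          ... | inj₁ (refl , _) | inj₁ (refl , _) = contradiction Evw E-irr
          ... | inj₁ (refl , e) | inj₂ (_ , e′) =
            contradiction (trans (sym e′) (trans (sym eq) e)) (nbr≢deep Evw)
          ... | inj₂ (_ , e) | inj₁ (refl , e′) =
            contradiction (trans (sym e) (trans eq e′)) (nbr≢deep (E-sym Evw))
          ... | inj₂ (_ , e) | inj₂ (_ , e′) = trans e (proper Evw (trans (sym e) (trans eq e′)))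

          pack′ : ∀ {v w m} → col′ v ≡ deep → col′ w ≡ deep → E v m → E m w → v ≡ w
          pack′ {v} {w} v-deep w-deep Evm Emw with ≔-view col u deep v | ≔-view col u deep w
          ... | inj₁ (v≡u , _) | inj₁ (w≡u , _) = trans v≡u (sym w≡u)
          ... | inj₁ (refl , _) | inj₂ (_ , e) = contradiction (trans (sym e) w-deep) (far≢deep Evm Emw)
          ... | inj₂ (_ , e) | inj₁ (refl , _) =
            contradiction (trans (sym e) v-deep) (far≢deep (E-sym Emw) (E-sym Evm))
          ... | inj₂ (_ , e) | inj₂ (_ , e′) = pack (trans (sym e) v-deep) (trans (sym e′) w-deep) Evm Emw

          safe′ : ∀ {v} → col′ v ≡ deep → Safe v
          safe′ {v} v-deep Evx x∈ with ≔-view col u deep v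
          ... | inj₁ (refl , _) = contradiction x∈ (nbr∉ Evx)
          ... | inj₂ (_ , e) = safe (trans (sym e) v-deep) Evx x∈

          hit′ : ∀ {v} → In v → col′ v ≡ deep ⊎ ∃ λ m → Mate v m × col′ m ≡ deep
          hit′ v∈ with hit v∈
          ... | inj₁ v-deep = inj₁ (deep⁺ v-deep)
          ... | inj₂ (m , mate , m-deep) = inj₂ (m , mate , deep⁺ m-deep)

        deep-extension : Extension col u
        deep-extension = col′ , record
          { full = λ v∈ → ≔-filled (λ ()) (full v∈)
          ; proper = proper′ ; pack = pack′ ; safe = safe′ ; hit = hit′ }
          , ≔-filled (λ ()) , λ e → contradiction (trans (sym (≔-same col u)) e) λ ()

    -- Inserting a vertex between two different pale colours

    module Insert {col : V → Colour} (valid : Valid col) {u} (u-blank : col u ≡ blank) {p q β}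
      (Eup : E u p) (Euq : E u q) (p-pale : col p ≡ pale β) (q-pale : col q ≡ pale (not β)) where

      open Valid valid

      u∉ : ¬ In u
      u∉ u∈ = full u∈ u-blank

      u≢deep : col u ≢ deep
      u≢deep e = contradiction (trans (sym u-blank) e) λ ()

      p≢q : p ≢ q
      p≢q refl = not-¬ refl (pale-injective (trans (sym p-pale) q-pale))

      only : ∀ {v} → E u v → v ≡ p ⊎ v ≡ q
      only = small-nbr (¬In⇒¬Big u∉) Eup Euq p≢q

      -- Outside the triangles `p` has no neighbours but the blank `u` and the deep `m`, so it can
      -- switch to the colour of `q`, which frees `β` for `u`.
      recolour : ∀ {m} → ¬ In p → E p m → col m ≡ deep → Extension col u
      recolour {m} p∉ Epm m-deep = via (≔-filled (λ ()))
        (Recolour.pale-extension (Recolour.pale-valid valid (IsPale≢deep (_ , p-pale)) p-free) u≢deep′ u-free)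
        where
        p-free : ∀ {v} → E p v → col v ≢ pale (not β)
        p-free Epv v-pale
          with small-nbr (¬In⇒¬Big p∉) (E-sym Eup) Epm (λ { refl → u≢deep m-deep }) Epv
        ... | inj₁ refl = contradiction (trans (sym u-blank) v-pale) λ ()
        ... | inj₂ refl = contradiction (trans (sym m-deep) v-pale) λ ()

        col′ : V → Colour
        col′ = col [ p ≔ pale (not β) ]

        u≢deep′ : col′ u ≢ deep
        u≢deep′ e = u≢deep (trans (sym (≔-other col (E⇒≢ Eup))) e)

        u-free : ∀ {v} → E u v → col′ v ≢ pale β
        u-free Euv v-pale with only Euv
        ... | inj₁ refl = not-¬ refl (pale-injective (trans (sym v-pale) (≔-same col p)))
        ... | inj₂ refl = not-¬ refl (pale-injective
          (trans (sym v-pale) (trans (≔-other col (≢-sym p≢q)) q-pale)))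

      -- Moving the deep colour of the triangle of p from z to p breaks the odd cycle through u.
      move-deep : ∀ {z} → Mate p z → col z ≡ deep → (∀ {v} → E z v → v ≢ p → col v ≢ pale β) → Extension col u
      move-deep {z} pz z-deep z-free = via keep (Recolour.pale-extension moved-valid u≢deep′ u-free)
        where
        p∈ : In p
        p∈ = proj₁ pz

        p-nbr : ∀ {v} → E p v → v ≡ u ⊎ Mate p v
        p-nbr = outer-nbr p∈ (E-sym Eup) (u∉ ∘ Mate⇒In)

        moved : V → Colour
        moved = col [ z ≔ pale β ] [ p ≔ deep ]

        keep : ∀ {v} → col v ≢ blank → moved v ≢ blank
        keep = ≔-filled (λ ()) ∘ ≔-filled (λ ())

        data View (v : V) : Set where
          is-p  : v ≡ p → moved v ≡ deep → View v
          is-z  : v ≡ z → moved v ≡ pale β → View v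
          other : v ≢ p → v ≢ z → moved v ≡ col v → View v

        view : ∀ v → View v
        view v with ≔-view (col [ z ≔ pale β ]) p deep v
        ... | inj₁ (v≡p , e) = is-p v≡p e
        ... | inj₂ (v≢p , e) with ≔-view col z (pale β) v
        ... | inj₁ (v≡z , e′) = is-z v≡z (trans e e′)
        ... | inj₂ (v≢z , e′) = other v≢p v≢z (trans e e′)

        moved-p : moved p ≡ deep
        moved-p = ≔-same _ p

        deep⁻ : ∀ {v} → moved v ≡ deep → v ≡ p ⊎ (v ≢ z × v ≢ p × col v ≡ deep)
        deep⁻ {v} v-deep with view v
        ... | is-p v≡p _ = inj₁ v≡p
        ... | is-z _ e = contradiction (trans (sym e) v-deep) λ ()
        ... | other v≢p v≢z e = inj₂ (v≢z , v≢p , trans (sym e) v-deep)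

        deep⁺ : ∀ {v} → v ≢ z → col v ≡ deep → moved v ≡ deep
        deep⁺ {v} v≢z v-deep with view v
        ... | is-p _ e = e
        ... | is-z v≡z _ = contradiction v≡z v≢z
        ... | other _ _ e = trans e v-deep

        proper-p : ∀ {w} → E p w → moved w ≢ deep
        proper-p Epw w-deep with deep⁻ w-deep
        ... | inj₁ refl = E-irr Epw
        ... | inj₂ (w≢z , _ , w-deep₀) with p-nbr Epw
        ... | inj₁ refl = u≢deep w-deep₀
        ... | inj₂ pw = proper-deep (Mate⇒E (Mate-trans pw pz w≢z)) w-deep₀ z-deep

        proper-z : ∀ {w} → E z w → moved w ≢ pale β
        proper-z {w} Ezw w-pale with view w
        ... | is-p _ e = contradiction (trans (sym e) w-pale) λ ()
        ... | is-z refl _ = E-irr Ezw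
        ... | other w≢p _ e = z-free Ezw w≢p (trans (sym e) w-pale)

        moved-proper : ∀ {v w} → E v w → moved v ≡ moved w → moved v ≡ blank
        moved-proper {v} {w} Evw eq with view v | view w
        ... | is-p refl e | _ = contradiction (trans (sym eq) e) (proper-p Evw)
        ... | is-z refl e | _ = contradiction (trans (sym eq) e) (proper-z Evw)
        ... | other _ _ _ | is-p refl e = contradiction (trans eq e) (proper-p (E-sym Evw))
        ... | other _ _ _ | is-z refl e = contradiction (trans eq e) (proper-z (E-sym Evw))
        ... | other _ _ e | other _ _ e′ = trans e (proper Evw (trans (sym e) (trans eq e′)))

        -- Through `u` only the pale `q` is reached. Through a mate, another deep `w` would already
        -- have been within distance 2 of `z`.
        pack-p : ∀ {w m} → E p m → E m w → w ≢ p → w ≢ z → col w ≢ deep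
        pack-p {w} {m} Epm Emw w≢p w≢z w-deep with p-nbr Epm
        ... | inj₁ refl with only Emw
        ... | inj₁ w≡p = w≢p w≡p
        ... | inj₂ refl = contradiction (trans (sym w-deep) q-pale) λ ()
        pack-p {w} {m} Epm Emw w≢p w≢z w-deep | inj₂ pm with m ≟ z
        ... | yes refl = proper-deep Emw z-deep w-deep
        ... | no m≢z =
          w≢z (sym (pack z-deep w-deep (E-sym (Mate⇒E (Mate-trans pm pz m≢z))) Emw))

        moved-pack : ∀ {v w m} → moved v ≡ deep → moved w ≡ deep → E v m → E m w → v ≡ w
        moved-pack v-deep w-deep Evm Emw with deep⁻ v-deep | deep⁻ w-deep
        ... | inj₁ v≡p | inj₁ w≡p = trans v≡p (sym w≡p)
        ... | inj₁ refl | inj₂ (w≢z , w≢p , e) = contradiction e (pack-p Evm Emw w≢p w≢z)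
        ... | inj₂ (v≢z , v≢p , e) | inj₁ refl =
          contradiction e (pack-p (E-sym Emw) (E-sym Evm) v≢p v≢z)
        ... | inj₂ (_ , _ , e) | inj₂ (_ , _ , e′) = pack e e′ Evm Emw

        moved-safe : ∀ {v} → moved v ≡ deep → Safe v
        moved-safe v-deep Evx x∈ with deep⁻ v-deep
        ... | inj₂ (_ , _ , e) = safe e Evx x∈
        ... | inj₁ refl with p-nbr Evx
        ... | inj₁ refl = contradiction x∈ u∉
        ... | inj₂ px = px

        moved-hit : ∀ {v} → In v → moved v ≡ deep ⊎ ∃ λ m → Mate v m × moved m ≡ deep
        moved-hit {v} v∈ with v ≟ p
        ... | yes refl = inj₁ moved-p
        ... | no v≢p with hit v∈
        ... | inj₁ v-deep with v ≟ z
        ... | yes refl = inj₂ (p , Mate-sym pz , moved-p)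
        ... | no v≢z = inj₁ (deep⁺ v≢z v-deep)
        moved-hit {v} v∈ | no v≢p | inj₂ (m , vm , m-deep) with m ≟ z
        ... | yes refl = inj₂ (p , Mate-trans (Mate-sym vm) (Mate-sym pz) v≢p , moved-p)
        ... | no m≢z = inj₂ (m , vm , deep⁺ m≢z m-deep)

        moved-valid : Valid moved
        moved-valid = record
          { full = λ v∈ → keep (full v∈) ; proper = moved-proper ; pack = moved-pack
          ; safe = moved-safe ; hit = moved-hit }

        u≢deep′ : moved u ≢ deep
        u≢deep′ e with deep⁻ e
        ... | inj₁ refl = E-irr Eup
        ... | inj₂ (_ , _ , e′) = u≢deep e′

        u-free : ∀ {v} → E u v → moved v ≢ pale β
        u-free {v} Euv v-pale with only Euv
        ... | inj₁ refl = contradiction (trans (sym moved-p) v-pale) λ ()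
        ... | inj₂ refl with view v
        ... | is-p v≡p _ = p≢q (sym v≡p)
        ... | is-z refl _ = contradiction (trans (sym q-pale) z-deep) λ ()
        ... | other _ _ e = not-¬ refl (pale-injective (trans (sym (trans (sym e) v-pale)) q-pale))

    module InsertAtTriangle {col : V → Colour} (valid : Valid col) {u} (u-blank : col u ≡ blank) {p q β}
      (Eup : E u p) (Euq : E u q) (p-pale : col p ≡ pale β) (q-pale : col q ≡ pale (not β))
      (p∈ : In p) (κ : Valid.Chain valid p) where

      open Valid valid
      open Insert valid u-blank Eup Euq p-pale q-pale

      open Chain κ
      open Swap valid κ

      swapped-blank : swapped u ≡ blank
      swapped-blank = swapped-same u-blank blank≢pale

      swapped-p : swapped p ≡ pale (not β)
      swapped-p = trans (swapped-∈ start∈) (cong toggle p-pale)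

      -- If the chain of `p` misses `q`, swapping it gives both neighbours of `u` the same colour.
      -- Otherwise the deep colour moves from `z` to `p`, directly unless some `z′` next to `z` has
      -- the colour `β` that `z` would take. In that case the swap precedes the move: `z` then takes
      -- `not β`, while `z′`, being an end other than `p` and `q`, is off the chain and keeps `β`.
      extension : Extension col u
      extension with q ∈? K
      ... | no q∉K = via swapped-filled (Recolour.pale-extension swapped-valid
          (λ e → contradiction (trans (sym swapped-blank) e) λ ()) u-free)
        where
        u-free : ∀ {v} → E u v → swapped v ≢ pale β
        u-free Euv v-pale with only Euv
        ... | inj₁ refl = not-¬ refl (pale-injective (trans (sym v-pale) swapped-p))
        ... | inj₂ refl = not-¬ refl (pale-injective
          (trans (sym v-pale) (trans (swapped-∉ q∉K) q-pale)))
      ... | yes q∈K with deep-mate p∈ (_ , p-pale)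
      ... | z , pz , z-deep with any? (λ v → E? z v ×-dec ¬? (v ≟ p) ×-dec col v ≟ᶜ pale β)
      ... | no none = move-deep pz z-deep λ Ezv v≢p v-pale → none (_ , Ezv , v≢p , v-pale)
      ... | yes (z′ , Ezz′ , z′≢p , z′-pale) = via swapped-filled
        (Insert.move-deep swapped-valid swapped-blank Eup Euq swapped-p
          (trans (swapped-∈ q∈K) (cong toggle q-pale)) pz (swapped-same z-deep deep≢pale) z-free)
        where
        -- By `safe`, a triangle containing `z′` would be that of `z` and `p`, and then `z′` would
        -- be adjacent to `p` with the same colour.
        z′∉ : ¬ In z′
        z′∉ z′∈ = proper-pale
          (Mate⇒E (Mate-trans (Mate-sym pz) (safe z-deep Ezz′ z′∈) (≢-sym z′≢p))) p-pale z′-pale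

        -- Both ends of the chain K are already known, p and q.
        z′∉K : z′ ∉ K
        z′∉K z′∈K = not-¬ refl (pale-injective (trans (sym z′-pale) (trans (cong col z′≡q) q-pale)))
          where
          z′≡q : z′ ≡ q
          z′≡q = ends z′∈K (deep-nbr⇒End z′∉ (E-sym Ezz′) z-deep) z′≢p
            q∈K (blank-nbr⇒End (_ , q-pale) (E-sym Euq) u-blank) (≢-sym p≢q)

        z-free : ∀ {v} → E z v → v ≢ p → swapped v ≢ pale (not β)
        z-free {v} Ezv v≢p v-pale with outer-nbr (Mate⇒In pz) Ezz′ (z′∉ ∘ Mate⇒In) Ezv
        ... | inj₁ refl = not-¬ refl (pale-injective
          (trans (sym z′-pale) (trans (sym (swapped-∉ z′∉K)) v-pale)))
        -- The remaining mate is adjacent to `p`, so it differs from the colour that `z` inherits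
        -- from `p`.
        ... | inj₂ zv = swapped-proper (Mate⇒E pv) swapped-p v-pale
          where
          pv : Mate p v
          pv = Mate-trans (Mate-sym pz) zv (≢-sym v≢p)

    insert : ∀ {col} → Valid col → ∀ {u} → col u ≡ blank → Extension col u
    insert {col} valid {u} u-blank
      with any? (λ v → E? u v ×-dec col v ≟ᶜ pale true) | any? (λ v → E? u v ×-dec col v ≟ᶜ pale false)
    ... | no none | _ = Recolour.pale-extension valid
      (λ e → contradiction (trans (sym u-blank) e) λ ()) (λ Euv e → none (_ , Euv , e))
    ... | yes _ | no none = Recolour.pale-extension valid
      (λ e → contradiction (trans (sym u-blank) e) λ ()) (λ Euv e → none (_ , Euv , e))
    ... | yes (p , Eup , p-pale) | yes (q , Euq , q-pale) with In? p | In? q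
    ... | yes p∈ | _ = InsertAtTriangle.extension valid u-blank Eup Euq p-pale q-pale p∈
      (chain (_ , p-pale) (blank-nbr⇒End (_ , p-pale) (E-sym Eup) u-blank))
      where open Valid valid
    ... | no _ | yes q∈ = InsertAtTriangle.extension valid u-blank Euq Eup q-pale p-pale q∈
      (chain (_ , q-pale) (blank-nbr⇒End (_ , q-pale) (E-sym Euq) u-blank))
      where open Valid valid
    ... | no p∉ | no q∉
      with any? (λ v → E? p v ×-dec col v ≟ᶜ deep) | any? (λ v → E? q v ×-dec col v ≟ᶜ deep)
    ... | yes (m , Epm , m-deep) | _ = Insert.recolour valid u-blank Eup Euq p-pale q-pale p∉ Epm m-deep
    ... | no _ | yes (m , Eqm , m-deep) = Insert.recolour valid u-blank Euq Eup q-pale p-pale q∉ Eqm m-deep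
    -- All paths from `u` start at `p` or `q`; neither is deep or has a deep neighbour, so no deep
    -- vertex is within distance 2.
    ... | no p-free | no q-free = Recolour.deep-extension valid u≢deep u∉
        (λ Euv v∈ → [ (λ { refl → p∉ v∈ }) , (λ { refl → q∉ v∈ }) ]′ (only Euv))
        (λ Euv v-deep → [ (λ { refl → clash (λ ()) p-pale v-deep }) , (λ { refl → clash (λ ()) q-pale v-deep }) ]′
          (only Euv))
        (λ Euv Evw w-deep → [ (λ { refl → p-free (_ , Evw , w-deep) }) , (λ { refl → q-free (_ , Evw , w-deep) }) ]′
          (only Euv))
      where open Insert valid u-blank Eup Euq p-pale q-pale

    -- The initial colouring of the triangle vertices

    module Initial (s : Selection) (hits : Hits s) where

      open Selection s

      M : V → V → Set
      M v w = Mate v w × v ∉ C × w ∉ C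

      N : V → V → Set
      N v w = In v × In w × E v w × ¬ Mate v w

      -- If `v` and two different mates all avoided `C`, their triangle would be free, which `hits`
      -- excludes.
      M-unique : ∀ {v w w′} → M v w → M v w′ → w ≡ w′
      M-unique {w = w} {w′} (vw , v∉ , w∉) (vw′ , _ , w′∉) = decidable-stable (w ≟ w′) λ w≢w′ →
        hits (proj₁ vw , v∉ , mate∉ w≢w′ (proj₁ vw , inj₁ refl) , mate∉ w≢w′ (proj₁ vw , inj₂ refl))
        where
        mate∉ : w ≢ w′ → ∀ {x} → Mate _ x → x ∉ C
        mate∉ w≢w′ vx = [ (λ { refl → w∉ }) , (λ { refl → w′∉ }) ]′ (third vw vw′ w≢w′ vx)

      open TwoMatchings M N (λ v w → Mate? v w ×-dec ¬? (v ∈? C) ×-dec ¬? (w ∈? C))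
        (λ v w → In? v ×-dec In? w ×-dec E? v w ×-dec ¬? (Mate? v w))
        (λ (vw , v∉ , w∉) → Mate-sym vw , w∉ , v∉)
        (λ (v∈ , w∈ , Evw , ¬vw) → w∈ , v∈ , E-sym Evw , ¬vw ∘ Mate-sym)
        (λ (vv , _) → E-irr (Mate⇒E vv)) (λ (_ , _ , Evv , _) → E-irr Evv)
        M-unique (λ (v∈ , _ , Evw , ¬vw) (_ , _ , Evw′ , ¬vw′) → outer-unique v∈ Evw′ ¬vw′ Evw ¬vw)
        using (2-colouring)

      hit : ∀ {v} → In v → v ∈ C ⊎ ∃ λ m → Mate v m × m ∈ C
      hit {v} v∈ with v ∈? C | ρ v ∈? C | ρ (ρ v) ∈? C
      ... | yes v∈C | _ | _ = inj₁ v∈C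
      ... | no _ | yes ρ∈C | _ = inj₂ (ρ v , (v∈ , inj₁ refl) , ρ∈C)
      ... | no _ | no _ | yes ρρ∈C = inj₂ (ρ (ρ v) , (v∈ , inj₂ refl) , ρρ∈C)
      ... | no v∉C | no ρ∉C | no ρρ∉C = contradiction (v∈ , v∉C , ρ∉C , ρρ∉C) hits

      module _ (f : V → Bool) (f-M : ∀ {v w} → M v w → f v ≢ f w) (f-N : ∀ {v w} → N v w → f v ≢ f w) where

        paint : ∀ {v} → Dec (v ∈ C) → Dec (In v) → Colour
        paint (yes _) _ = deep
        paint {v} (no _) (yes _) = pale (f v)
        paint (no _) (no _) = blank

        initial : V → Colour
        initial v = paint (v ∈? C) (In? v)

        data View (v : V) : Set where
          is-deep  : v ∈ C → initial v ≡ deep → View v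
          is-pale  : v ∉ C → In v → initial v ≡ pale (f v) → View v
          is-blank : ¬ In v → initial v ≡ blank → View v

        view : ∀ v → View v
        view v = cases (v ∈? C) (In? v) refl
          where
          cases : (d : Dec (v ∈ C)) (e : Dec (In v)) → initial v ≡ paint d e → View v
          cases (yes v∈C) _ eq = is-deep v∈C eq
          cases (no v∉C) (yes v∈) eq = is-pale v∉C v∈ eq
          cases (no _) (no v∉) eq = is-blank v∉ eq

        deep⁻ : ∀ {v} → initial v ≡ deep → v ∈ C
        deep⁻ {v} v-deep with view v
        ... | is-deep v∈C _ = v∈C
        ... | is-pale _ _ e = contradiction (trans (sym e) v-deep) λ ()
        ... | is-blank _ e = contradiction (trans (sym e) v-deep) λ ()

        deep⁺ : ∀ {v} → v ∈ C → initial v ≡ deep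
        deep⁺ {v} v∈C with view v
        ... | is-deep _ e = e
        ... | is-pale v∉C _ _ = contradiction v∈C v∉C
        ... | is-blank v∉ _ = contradiction (C⊆In v∈C) v∉

        filled : ∀ {v} → In v → initial v ≢ blank
        filled {v} v∈ v-blank with view v
        ... | is-deep _ e = contradiction (trans (sym e) v-blank) λ ()
        ... | is-pale _ _ e = contradiction (trans (sym e) v-blank) λ ()
        ... | is-blank v∉ _ = v∉ v∈

        initial-proper : ∀ {v w} → E v w → initial v ≡ initial w → initial v ≡ blank
        initial-proper {v} {w} Evw eq with view v | view w
        ... | is-blank _ e | _ = e
        ... | _ | is-blank _ e = trans eq e
        ... | is-deep v∈C _ | is-deep w∈C _ = contradiction (safe v∈C Evw (C⊆In w∈C)) (one v∈C w∈C)
        ... | is-deep _ e | is-pale _ _ e′ = contradiction (trans (sym e) (trans eq e′)) λ ()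
        ... | is-pale _ _ e | is-deep _ e′ = contradiction (trans (sym e) (trans eq e′)) λ ()
        ... | is-pale v∉C v∈ e | is-pale w∉C w∈ e′ with Mate? v w
        ... | yes vw = contradiction (pale-injective (trans (sym e) (trans eq e′)))
          (f-M (vw , v∉C , w∉C))
        ... | no ¬vw = contradiction (pale-injective (trans (sym e) (trans eq e′)))
          (f-N (v∈ , w∈ , Evw , ¬vw))

        -- A common neighbour outside the triangles is handled by `apart`; one inside is, by `safe`,
        -- a mate of both, and a triangle has only one chosen vertex.
        initial-pack : ∀ {v w m} → v ∈ C → w ∈ C → E v m → E m w → v ≡ w
        initial-pack {v} {w} {m} v∈C w∈C Evm Emw with In? m
        ... | no m∉ = apart v∈C w∈C m∉ Evm (E-sym Emw)
        ... | yes m∈ = decidable-stable (v ≟ w) λ v≢w → one v∈C w∈C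
          (Mate-trans (Mate-sym (safe v∈C Evm m∈)) (Mate-sym (safe w∈C (E-sym Emw) m∈)) v≢w)

        initial-hit : ∀ {v} → In v → initial v ≡ deep ⊎ ∃ λ m → Mate v m × initial m ≡ deep
        initial-hit v∈ with hit v∈
        ... | inj₁ v∈C = inj₁ (deep⁺ v∈C)
        ... | inj₂ (m , vm , m∈C) = inj₂ (m , vm , deep⁺ m∈C)

        initial-valid : Valid initial
        initial-valid = record
          { full = filled ; proper = initial-proper
          ; pack = λ v-deep w-deep → initial-pack (deep⁻ v-deep) (deep⁻ w-deep)
          ; safe = λ v-deep → safe (deep⁻ v-deep) ; hit = initial-hit }

      initial-colouring : ∃ Valid
      initial-colouring = from 2-colouring
        where
        from : (∃ λ f → (∀ {v w} → M v w → f v ≢ f w) × (∀ {v w} → N v w → f v ≢ f w)) → ∃ Valid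
        from (f , f-M , f-N) = initial f f-M f-N , initial-valid f f-M f-N

    -- Completing the colouring and reading off the packing

    Total : (V → Colour) → Set
    Total col = ∀ v → col v ≢ blank

    total-colouring : ∃ Valid → ∃ λ (s : ∃ Valid) → Total (proj₁ s)
    total-colouring = saturate (λ (col , _) v → col v ≢ blank) (λ (col , _) v → ¬? (col v ≟ᶜ blank)) advance
      where
      advance : (s : ∃ Valid) → Total (proj₁ s) ⊎ ∃ λ (s′ : ∃ Valid) →
        (∀ {v} → proj₁ s v ≢ blank → proj₁ s′ v ≢ blank) ×
        ∃ λ v → ¬ (proj₁ s v ≢ blank) × proj₁ s′ v ≢ blank
      advance (col , valid) with any? (λ v → col v ≟ᶜ blank)
      ... | no none = inj₁ λ v v-blank → none (v , v-blank)
      ... | yes (u , u-blank) with insert valid u-blank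
      ... | col′ , valid′ , keep , filled = inj₂ ((col′ , valid′) , keep , u , (λ f → f u-blank) , filled)

    packing : (col : V → Colour) → Valid col → Total col → PackingColoring G 3 S112
    packing col valid total = class ∘ col , separated
      where
      open Valid valid

      class : Colour → Fin 3
      -- An arbitrary value: a total colouring has no blank vertex.
      class blank = zero
      class (pale false) = zero
      class (pale true) = suc zero
      class deep = suc (suc zero)

      class-injective : ∀ {c d} → c ≢ blank → d ≢ blank → class c ≡ class d → c ≡ d
      class-injective {blank} c≢ _ _ = contradiction refl c≢
      class-injective {_} {blank} _ d≢ _ = contradiction refl d≢
      class-injective {pale false} {pale false} _ _ _ = refl
      class-injective {pale true} {pale true} _ _ _ = refl
      class-injective {deep} {deep} _ _ _ = refl
      class-injective {pale false} {pale true} _ _ ()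
      class-injective {pale false} {deep} _ _ ()
      class-injective {pale true} {pale false} _ _ ()
      class-injective {pale true} {deep} _ _ ()
      class-injective {deep} {pale false} _ _ ()
      class-injective {deep} {pale true} _ _ ()

      radius : ∀ c → c ≢ deep → S112 (class c) ≡ 1
      radius blank _ = refl
      radius deep ≢deep = contradiction refl ≢deep
      radius (pale false) _ = refl
      radius (pale true) _ = refl

      separated : ∀ v w → v ≢ w → class (col v) ≡ class (col w) → ¬ DistLe G v w (S112 (class (col v)))
      separated v w v≢w same (ℓ , ℓ≤ , walk) = far walk ℓ≤
        where
        col≡ : col v ≡ col w
        col≡ = class-injective (total v) (total w) same

        far : ∀ {ℓ} → Walk G v w ℓ → ¬ ℓ ≤ S112 (class (col v))
        far here _ = v≢w refl
        far (step Evw here) _ = total v (proper Evw col≡)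
        far (step Evm (step Emw here)) 2≤ with col v ≟ᶜ deep
        ... | yes v-deep = v≢w (pack v-deep (trans (sym col≡) v-deep) Evm Emw)
        ... | no v≢deep with subst (2 ≤_) (radius (col v) v≢deep) 2≤
        ... | s≤s ()
        far (step _ (step _ (step _ _))) 3≤ with col v ≟ᶜ deep
        ... | yes v-deep with subst (λ c → _ ≤ S112 (class c)) v-deep 3≤
        ... | s≤s (s≤s ())
        far (step _ (step _ (step _ _))) 3≤ | no v≢deep with subst (_ ≤_) (radius (col v) v≢deep) 3≤
        ... | s≤s ()

    coloured : V → PackingColoring G 3 S112
    coloured v = uncurry (uncurry packing) (total-colouring (uncurry Initial.initial-colouring (selection v)))

theorem3 : (G : Graph) → Subcubic G → Saturated G 2 → G3Is G 3 →
    PackingColoring G 3 S112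
-- The vertex of degree 3 supplied by `girth` becomes the initial value of `blocked`.
theorem3 G subcubic saturated girth = WithFamily.coloured (proj₁ covering) (proj₂ covering) (proj₁ (proj₁ girth))
  where open Packing G subcubic saturated girth
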